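{- For all positive integers $k$, $n$ and $\delta$, $$\Phi_k(n)\le\left(\frac{\delta\,(1+\tau)\,k!}{\zeta(k,\delta)}\right)^{1/k} n^{1/k}+\frac{e-1}{e}\,k,$$ where $\tau=0$ if $k$ is even and $\tau=1$ if $k$ is odd.
   Context: A finite set $\mathcal A$ of non-negative integers is a $B_k$-sequence if all sums $a_1+\dots+a_k$ of $k$ elements of $\mathcal A$ (repetitions allowed) are different, i.e. distinct multisets $\{a_1,\dots,a_k\}$ of elements of $\mathcal A$ have distinct sums. $\Phi_k(n)$ is the maximum size of a $B_k$-sequence contained in $[0,n]$. For positive integers $m$ and $\delta$, a $\delta$-deviation set of size $m$ is a finite sequence $(\alpha_1,\dots,\alpha_\ell)$ of positive integers such that (i) $\sum_i\alpha_i=m$; (ii) $\big|\sum_i\alpha_{2i-1}-\sum_i\alpha_{2i}\big|\le 1$; (iii) $\big|\sum_{1\le i\le j}(-1)^{i-1}\alpha_i\big|\le\delta$ for every $j\ge1$; and $\zeta(m,\delta)$ is the number of $\delta$-deviation sets of size $m$. -}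

module Defs where

open import Data.Bool using (if_then_else_)
open import Data.Fin using (Fin; toℕ)
import Data.Fin.Properties as Fin
open import Data.Fin.Subset as Subset using (Subset; inside; outside)
open import Data.Fin.Subset.Properties as Subset using ()
open import Data.Integer as ℤ using (ℤ; +_)
import Data.Integer.Properties as ℤ
open import Data.List using (List; []; _∷_; _++_; length; map; filter; concatMap; upTo; take; replicate)
open import Data.List.Extrema.Nat using (max)
open import Data.List.Membership.DecPropositional using () renaming (_∈?_ to ∈?)
open import Data.List.Membership.Propositional using (_∈_; lose)
open import Data.List.Membership.Propositional.Properties
  using (∈-∃++; ∈-filter⁺; ∈-map⁺; ∈-concatMap⁺; ∈-upTo⁺; ∈-length)
open import Data.List.Relation.Binary.Permutation.Propositional
  using (_↭_; ↭-refl; ↭-trans; ↭-sym; prep)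
open import Data.List.Relation.Binary.Permutation.Propositional.Properties
  using (∈-resp-↭; shift; drop-mid; ↭-empty-inv)
open import Data.List.Relation.Unary.All as All using (All; []; _∷_)
open import Data.List.Relation.Unary.Any using (here)
open import Data.Nat as ℕ using (ℕ; zero; suc; NonZero; _!; _^_; _%_; z≤n; s≤s; ∣_-_∣)
import Data.Nat.ListAction as ℕ
import Data.Nat.Properties as ℕ
open import Data.Nat.Properties using (_!≢0)
open import Data.Product using (∃; ∃-syntax; _×_; _,_; proj₁; proj₂)
open import Data.Rational as ℚ using (ℚ; 0ℚ; 1ℚ; ½; _/_; ↥_; ↧ₙ_; mkℚ)
import Data.Rational.Properties as ℚ
open import Data.Rational.Solver using (module +-*-Solver)
import Data.Rational.Unnormalised as ℚᵘ
import Data.Rational.Unnormalised.Properties as ℚᵘ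
open import Data.Sum using (_⊎_; inj₁; inj₂)
open import Data.Vec as Vec using (Vec; []; _∷_)
import Data.Vec.Relation.Unary.All as VecAll
open import Function using (_∘_)
open import Relation.Binary.Definitions using (DecidableEquality)
open import Relation.Binary.PropositionalEquality
open import Relation.Nullary using (Dec; yes; no; does; ¬_; contradiction)
open import Relation.Nullary.Decidable using (_×-dec_; _→-dec_; map′)
open import Relation.Unary using (Decidable)

-- A multiset of size k is a vector of length k up to permutation.
IsB : ∀ {n} → ℕ → Subset n → Set
IsB {n} k A = ∀ (u v : Vec (Fin n) k) →
  VecAll.All (Subset._∈ A) u → VecAll.All (Subset._∈ A) v →
  Vec.sum (Vec.map toℕ u) ≡ Vec.sum (Vec.map toℕ v) →
  Vec.toList u ↭ Vec.toList v

↭-dec : ∀ {A : Set} → DecidableEquality A → (xs ys : List A) → Dec (xs ↭ ys)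
↭-dec _≟_ [] [] = yes ↭-refl
↭-dec _≟_ [] (y ∷ ys) = no λ p → contradiction (↭-empty-inv (↭-sym p)) λ ()
↭-dec _≟_ (x ∷ xs) ys with ∈? _≟_ x ys
... | no x∉ys = no λ p → x∉ys (∈-resp-↭ p (here refl))
... | yes x∈ys with ∈-∃++ x∈ys
...   | ws , zs , refl = map′
        (λ p → ↭-trans (prep x p) (↭-sym (shift x ws zs)))
        (drop-mid [] ws)
        (↭-dec _≟_ xs (ws ++ zs))

allVec? : ∀ {n} k {P : Vec (Fin n) k → Set} → Decidable P → Dec (∀ v → P v)
allVec? zero    P? = map′ (λ { p [] → p }) (λ f → f []) (P? [])
allVec? (suc k) P? = map′ (λ { f (x ∷ v) → f x v }) (λ f x v → f (x ∷ v))
  (Fin.all? λ x → allVec? k λ v → P? (x ∷ v))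

isB? : ∀ {n} k → Decidable (IsB {n} k)
isB? k A = allVec? k λ u → allVec? k λ v →
  VecAll.all? (Subset._∈? A) u →-dec
  (VecAll.all? (Subset._∈? A) v →-dec
  (Vec.sum (Vec.map toℕ u) ℕ.≟ Vec.sum (Vec.map toℕ v) →-dec
  ↭-dec Fin._≟_ (Vec.toList u) (Vec.toList v)))

subsets : ∀ n → List (Subset n)
subsets zero    = [] ∷ []
subsets (suc n) = map (inside ∷_) (subsets n) ++ map (outside ∷_) (subsets n)

-- Subset (suc n) is the type of subsets of [0,n]; the default 0 is the size of the empty set.
Φ : ℕ → ℕ → ℕ
Φ k n = max 0 (map Subset.∣_∣ (filter (isB? k) (subsets (suc n))))

-- For α = (α₁, …, α_ℓ): Σ α_{2i-1}, Σ α_{2i} and Σ (-1)^{i-1} α_i.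
sumOdd sumEven : List ℕ → ℕ
sumOdd []       = 0
sumOdd (a ∷ as) = a ℕ.+ sumEven as
sumEven []       = 0
sumEven (a ∷ as) = sumOdd as

altSum : List ℕ → ℤ
altSum []       = + 0
altSum (a ∷ as) = + a ℤ.- altSum as

-- The last condition is stated for 1 ≤ j ≤ ℓ; for j > ℓ the sum is the one for j = ℓ.
IsDeviation : ℕ → ℕ → List ℕ → Set
IsDeviation m δ α =
  All (0 ℕ.<_) α ×
  ℕ.sum α ≡ m ×
  ∣ sumOdd α - sumEven α ∣ ℕ.≤ 1 ×
  (∀ (j : Fin (length α)) → ℤ.∣ altSum (take (suc (toℕ j)) α) ∣ ℕ.≤ δ)

isDeviation? : ∀ m δ → Decidable (IsDeviation m δ)
isDeviation? m δ α =
  All.all? (0 ℕ.<?_) α ×-dec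
  (ℕ.sum α ℕ.≟ m) ×-dec
  (∣ sumOdd α - sumEven α ∣ ℕ.≤? 1) ×-dec
  Fin.all? (λ j → ℤ.∣ altSum (take (suc (toℕ j)) α) ∣ ℕ.≤? δ)

tuples : ∀ {A : Set} → ℕ → List A → List (List A)
tuples zero    xs = [] ∷ []
tuples (suc ℓ) xs = concatMap (λ x → map (x ∷_) (tuples ℓ xs)) xs

-- A list of positive integers with sum m has length at most m and entries at most m,
-- and each list of length ≤ m over [0,m] occurs exactly once among the candidates.
ζ : ℕ → ℕ → ℕ
ζ m δ = length (filter (isDeviation? m δ)
                       (concatMap (λ ℓ → tuples ℓ (upTo (suc m))) (upTo (suc m))))

private
  ∈-tuples : ∀ {A : Set} {x : A} {xs} ℓ → x ∈ xs → replicate ℓ x ∈ tuples ℓ xs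
  ∈-tuples zero    x∈xs = here refl
  ∈-tuples (suc ℓ) x∈xs =
    ∈-concatMap⁺ _ (lose x∈xs (∈-map⁺ _ (∈-tuples ℓ x∈xs)))

  ones-positive : ∀ m → All (0 ℕ.<_) (replicate m 1)
  ones-positive zero    = []
  ones-positive (suc m) = s≤s z≤n ∷ ones-positive m

  ones-sum : ∀ m → ℕ.sum (replicate m 1) ≡ m
  ones-sum zero    = refl
  ones-sum (suc m) = cong suc (ones-sum m)

  ones-balanced : ∀ m →
    sumOdd (replicate m 1) ≡ sumEven (replicate m 1) ⊎
    sumOdd (replicate m 1) ≡ suc (sumEven (replicate m 1))
  ones-balanced zero = inj₁ refl
  ones-balanced (suc m) with ones-balanced m
  ... | inj₁ eq = inj₂ (cong suc (sym eq))
  ... | inj₂ eq = inj₁ (sym eq)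

  ones-difference : ∀ m → ∣ sumOdd (replicate m 1) - sumEven (replicate m 1) ∣ ℕ.≤ 1
  ones-difference m with sumOdd (replicate m 1) | sumEven (replicate m 1) | ones-balanced m
  ... | a | .a | inj₁ refl rewrite ℕ.∣n-n∣≡0 a = z≤n
  ... | .(suc b) | b | inj₂ refl = ℕ.≤-reflexive (trans (ℕ.∣-∣-comm (suc b) b) (lemma b))
    where
    lemma : ∀ b → ∣ b - suc b ∣ ≡ 1
    lemma zero    = refl
    lemma (suc b) = lemma b

  ones-altSum : ∀ j m →
    altSum (take j (replicate m 1)) ≡ + 0 ⊎ altSum (take j (replicate m 1)) ≡ + 1
  ones-altSum zero    m    = inj₁ refl
  ones-altSum (suc j) zero = inj₁ refl
  ones-altSum (suc j) (suc m) with ones-altSum j m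
  ... | inj₁ eq = inj₂ (cong (ℤ._-_ (+ 1)) eq)
  ... | inj₂ eq = inj₁ (cong (ℤ._-_ (+ 1)) eq)

  ones-bounded : ∀ δ .{{_ : NonZero δ}} j m → ℤ.∣ altSum (take j (replicate m 1)) ∣ ℕ.≤ δ
  ones-bounded (suc δ) j m with altSum (take j (replicate m 1)) | ones-altSum j m
  ... | _ | inj₁ refl = z≤n
  ... | _ | inj₂ refl = s≤s z≤n

ζ-nonZero : ∀ m δ .{{_ : NonZero m}} .{{_ : NonZero δ}} → NonZero (ζ m δ)
ζ-nonZero (suc m) δ = ℕ.>-nonZero (∈-length (∈-filter⁺ (isDeviation? (suc m) δ)
  (∈-concatMap⁺ (λ ℓ → tuples ℓ (upTo (suc (suc m)))) (lose (∈-upTo⁺ (ℕ.n<1+n (suc m)))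
    (∈-tuples (suc m) (∈-upTo⁺ {i = 1} (s≤s (s≤s z≤n))))))
  ( ones-positive (suc m) , ones-sum (suc m) , ones-difference (suc m)
  , λ j → ones-bounded δ (suc (toℕ j)) (suc m))))

τ : ℕ → ℕ
τ k = k % 2

IsCauchy : (ℕ → ℚ) → Set
IsCauchy x = ∀ ε → 0ℚ ℚ.< ε →
  ∃[ N ] ∀ m n → N ℕ.≤ m → N ℕ.≤ n → ℚ.∣ x m ℚ.- x n ∣ ℚ.≤ ε

record ℝ : Set where
  constructor mkℝ
  field
    seq    : ℕ → ℚ
    cauchy : IsCauchy seq

open ℝ public

infix 4 _≤_
_≤_ : ℝ → ℝ → Set
x ≤ y = ∀ ε → 0ℚ ℚ.< ε → ∃[ N ] ∀ m → N ℕ.≤ m → seq x m ℚ.≤ seq y m ℚ.+ ε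

infix 4 _#0
record _#0 (x : ℝ) : Set where
  constructor mk#0
  field
    bound          : ℚ
    bound-positive : 0ℚ ℚ.< bound
    index          : ℕ
    apart          : ∀ m → index ℕ.≤ m → bound ℚ.≤ ℚ.∣ seq x m ∣

private
  half : ∀ {ε} → 0ℚ ℚ.< ε → 0ℚ ℚ.< ½ ℚ.* ε
  half {ε} 0<ε = ℚ.positive⁻¹ _ {{ℚ.pos*pos⇒pos ½ ε {{ℚ.positive 0<ε}}}}

  half+half : ∀ ε → ½ ℚ.* ε ℚ.+ ½ ℚ.* ε ≡ ε
  half+half ε = trans (sym (ℚ.*-distribʳ-+ ε ½ ½)) (ℚ.*-identityˡ ε)

  *-pos : ∀ {p q} → 0ℚ ℚ.< p → 0ℚ ℚ.< q → 0ℚ ℚ.< p ℚ.* q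
  *-pos {p} {q} 0<p 0<q =
    ℚ.positive⁻¹ _ {{ℚ.pos*pos⇒pos p {{ℚ.positive 0<p}} q {{ℚ.positive 0<q}}}}

  *-mono : ∀ {p q r s} → 0ℚ ℚ.≤ r → 0ℚ ℚ.≤ q → p ℚ.≤ q → r ℚ.≤ s → p ℚ.* r ℚ.≤ q ℚ.* s
  *-mono {p} {q} {r} {s} 0≤r 0≤q p≤q r≤s = ℚ.≤-trans
    (ℚ.*-monoʳ-≤-nonNeg r {{ℚ.nonNegative 0≤r}} p≤q)
    (ℚ.*-monoˡ-≤-nonNeg q {{ℚ.nonNegative 0≤q}} r≤s)

  ∣p-q∣≡∣q-p∣ : ∀ p q → ℚ.∣ p ℚ.- q ∣ ≡ ℚ.∣ q ℚ.- p ∣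
  ∣p-q∣≡∣q-p∣ p q = trans
    (cong ℚ.∣_∣ (solve 2 (λ p q → p :- q := :- (q :- p)) refl p q))
    (ℚ.∣-p∣≡∣p∣ (q ℚ.- p))
    where open +-*-Solver

  p≤∣p∣ : ∀ p → p ℚ.≤ ℚ.∣ p ∣
  p≤∣p∣ p with ℚ.≤-total 0ℚ p
  ... | inj₁ 0≤p = ℚ.≤-reflexive (sym (ℚ.0≤p⇒∣p∣≡p 0≤p))
  ... | inj₂ p≤0 = ℚ.≤-trans p≤0 (ℚ.0≤∣p∣ p)

  p≤q+r⇒p-q≤r : ∀ {p r} q → p ℚ.≤ q ℚ.+ r → p ℚ.- q ℚ.≤ r
  p≤q+r⇒p-q≤r {p} {r} q p≤ = ℚ.≤-trans (ℚ.+-monoˡ-≤ (ℚ.- q) p≤)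
    (ℚ.≤-reflexive (solve 2 (λ q r → q :+ r :- q := r) refl q r))
    where open +-*-Solver

  ∣p-q∣≤r : ∀ {p q r} → p ℚ.≤ q ℚ.+ r → q ℚ.≤ p ℚ.+ r → ℚ.∣ p ℚ.- q ∣ ℚ.≤ r
  ∣p-q∣≤r {p} {q} {r} p≤ q≤ with ℚ.∣p∣≡p∨∣p∣≡-p (p ℚ.- q)
  ... | inj₁ eq = ℚ.≤-trans (ℚ.≤-reflexive eq) (p≤q+r⇒p-q≤r q p≤)
  ... | inj₂ eq = ℚ.≤-trans
    (ℚ.≤-reflexive (trans eq (solve 2 (λ p q → :- (p :- q) := q :- p) refl p q)))
    (p≤q+r⇒p-q≤r p q≤)
    where open +-*-Solver

  /-mono : ∀ i j c d .{{_ : NonZero c}} .{{_ : NonZero d}} →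
    i ℤ.* + d ℤ.≤ j ℤ.* + c → i / c ℚ.≤ j / d
  /-mono i j (suc c) (suc d) le = ℚ.toℚᵘ-cancel-≤ (ℚᵘ.≤-trans
    (ℚᵘ.≤-reflexive (ℚ.toℚᵘ-fromℚᵘ (ℚᵘ.mkℚᵘ i c))) (ℚᵘ.≤-trans
    (ℚᵘ.*≤* le)
    (ℚᵘ.≤-reflexive (ℚᵘ.≃-sym (ℚ.toℚᵘ-fromℚᵘ (ℚᵘ.mkℚᵘ j d))))))

  /-mono-ℕ : ∀ a b c d .{{_ : NonZero c}} .{{_ : NonZero d}} →
    a ℕ.* d ℕ.≤ b ℕ.* c → + a / c ℚ.≤ + b / d
  /-mono-ℕ a b c d le = /-mono (+ a) (+ b) c d
    (subst₂ ℤ._≤_ (ℤ.pos-* a d) (ℤ.pos-* b c) (ℤ.+≤+ le))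

  /-+ : ∀ a b d .{{_ : NonZero d}} → + a / d ℚ.+ + b / d ≡ + (a ℕ.+ b) / d
  /-+ a b (suc d) = ℚ.toℚᵘ-injective (ℚᵘ.≃-trans (ℚ.toℚᵘ-homo-+ (+ a / suc d) (+ b / suc d))
    (ℚᵘ.≃-trans (ℚᵘ.+-cong (ℚ.toℚᵘ-fromℚᵘ (ℚᵘ.mkℚᵘ (+ a) d)) (ℚ.toℚᵘ-fromℚᵘ (ℚᵘ.mkℚᵘ (+ b) d)))
    (ℚᵘ.≃-trans (ℚᵘ.*≡* eq) (ℚᵘ.≃-sym (ℚ.toℚᵘ-fromℚᵘ (ℚᵘ.mkℚᵘ (+ (a ℕ.+ b)) d))))))
    where
    D = + suc d
    eq : (+ a ℤ.* D ℤ.+ + b ℤ.* D) ℤ.* D ≡ + (a ℕ.+ b) ℤ.* (D ℤ.* D)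
    eq = trans (cong (ℤ._* D) (sym (ℤ.*-distribʳ-+ D (+ a) (+ b))))
      (ℤ.*-assoc (+ a ℤ.+ + b) D D)

  archimedean : ∀ c ε → 0ℚ ℚ.< ε → ∃[ N ] (+ c / suc N ℚ.≤ ε)
  archimedean c (mkℚ (+ zero) d _)   (ℚ.*<* (ℤ.+<+ ()))
  archimedean c (mkℚ ℤ.-[1+ n ] d _) (ℚ.*<* ())
  archimedean c ε@(mkℚ (+ suc p) d _) _ = c ℕ.* suc d , subst (+ c / suc (c ℕ.* suc d) ℚ.≤_)
    (ℚ.↥p/↧p≡p ε) (/-mono-ℕ c (suc p) (suc (c ℕ.* suc d)) (suc d)
      (ℕ.≤-trans (ℕ.n≤1+n _) (ℕ.m≤m+n _ _)))

  cauchy-from : ∀ c (x : ℕ → ℚ) → (∀ m n → x m ℚ.≤ x n ℚ.+ + c / suc n) → IsCauchy x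
  cauchy-from c x step ε 0<ε with archimedean c ε 0<ε
  ... | N , c/N≤ε = N , λ m n N≤m N≤n → ∣p-q∣≤r (close m n N≤n) (close n m N≤m)
    where
    close : ∀ m n → N ℕ.≤ n → x m ℚ.≤ x n ℚ.+ ε
    close m n N≤n = ℚ.≤-trans (step m n) (ℚ.+-monoʳ-≤ (x n)
      (ℚ.≤-trans (/-mono-ℕ c c (suc n) (suc N)
        (ℕ.*-monoʳ-≤ c (s≤s N≤n))) c/N≤ε))

  EventuallyBounded : (ℕ → ℚ) → ℚ → ℕ → Set
  EventuallyBounded x B N = ∀ m → N ℕ.≤ m → ℚ.∣ x m ∣ ℚ.≤ B

  eventually-bounded : ∀ {x} → IsCauchy x →
    ∃[ B ] ∃[ N ] (0ℚ ℚ.< B × EventuallyBounded x B N)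
  eventually-bounded {x} c with c 1ℚ (ℚ.positive⁻¹ 1ℚ)
  ... | N , f = ℚ.∣ x N ∣ ℚ.+ 1ℚ , N ,
    ℚ.+-mono-≤-< (ℚ.0≤∣p∣ (x N)) (ℚ.positive⁻¹ 1ℚ) , λ m N≤m → ℚ.≤-trans
      (ℚ.≤-reflexive (cong ℚ.∣_∣ (solve 2 (λ a b → a := b :+ (a :- b)) refl (x m) (x N))))
      (ℚ.≤-trans (ℚ.∣p+q∣≤∣p∣+∣q∣ (x N) (x m ℚ.- x N))
        (ℚ.+-monoʳ-≤ ℚ.∣ x N ∣ (f m N N≤m ℕ.≤-refl)))
    where open +-*-Solver

ℚ→ℝ : ℚ → ℝ
ℚ→ℝ q = mkℝ (λ _ → q) λ ε 0<ε → 0 , λ m n _ _ →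
  subst (ℚ._≤ ε) (cong ℚ.∣_∣ (sym (ℚ.+-inverseʳ q))) (ℚ.<⇒≤ 0<ε)

ℕ→ℝ : ℕ → ℝ
ℕ→ℝ n = ℚ→ℝ (+ n / 1)

infixl 6 _+_ _-_
infixl 7 _*_ _÷_

_+_ : ℝ → ℝ → ℝ
mkℝ x cx + mkℝ y cy = mkℝ (λ m → x m ℚ.+ y m) c
  where
  c : IsCauchy (λ m → x m ℚ.+ y m)
  c ε 0<ε with cx (½ ℚ.* ε) (half 0<ε) | cy (½ ℚ.* ε) (half 0<ε)
  ... | M , f | N , g = M ℕ.⊔ N , λ m n p q → ℚ.≤-trans
    (ℚ.≤-reflexive (cong ℚ.∣_∣ (solve 4
      (λ a b c d → (a :+ b) :- (c :+ d) := (a :- c) :+ (b :- d)) refl (x m) (y m) (x n) (y n))))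
    (ℚ.≤-trans (ℚ.∣p+q∣≤∣p∣+∣q∣ (x m ℚ.- x n) (y m ℚ.- y n))
    (ℚ.≤-trans (ℚ.+-mono-≤
      (f m n (ℕ.m⊔n≤o⇒m≤o M N p) (ℕ.m⊔n≤o⇒m≤o M N q))
      (g m n (ℕ.m⊔n≤o⇒n≤o M N p) (ℕ.m⊔n≤o⇒n≤o M N q)))
    (ℚ.≤-reflexive (half+half ε))))
    where open +-*-Solver

neg : ℝ → ℝ
neg (mkℝ x cx) = mkℝ (λ m → ℚ.- x m) λ ε 0<ε → proj₁ (cx ε 0<ε) , λ m n p q → ℚ.≤-trans
  (ℚ.≤-reflexive (trans
    (cong ℚ.∣_∣ (solve 2 (λ a b → (:- a) :- (:- b) := :- (a :- b)) refl (x m) (x n)))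
    (ℚ.∣-p∣≡∣p∣ (x m ℚ.- x n))))
  (proj₂ (cx ε 0<ε) m n p q)
  where open +-*-Solver

_-_ : ℝ → ℝ → ℝ
x - y = x + neg y

private
  shrink : ∀ {ε B} → 0ℚ ℚ.< ε → 0ℚ ℚ.< B → ∃[ η ] (0ℚ ℚ.< η × η ℚ.* B ≡ ½ ℚ.* ε)
  shrink {ε} {B} 0<ε 0<B = (½ ℚ.* ε) ℚ.* B⁻¹ ,
    *-pos (half 0<ε) (ℚ.positive⁻¹ B⁻¹ {{ℚ.1/pos⇒pos B {{ℚ.positive 0<B}}}}) ,
    trans (ℚ.*-assoc (½ ℚ.* ε) B⁻¹ B)
      (trans (cong ((½ ℚ.* ε) ℚ.*_) (ℚ.*-inverseˡ B {{B≢0}})) (ℚ.*-identityʳ (½ ℚ.* ε)))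
    where
    B≢0 : ℚ.NonZero B
    B≢0 = ℚ.pos⇒nonZero B {{ℚ.positive 0<B}}
    B⁻¹ : ℚ
    B⁻¹ = (ℚ.1/ B) {{B≢0}}

  product-close : ∀ a b c d {B η} → 0ℚ ℚ.≤ η → ℚ.∣ a ∣ ℚ.≤ B → ℚ.∣ d ∣ ℚ.≤ B →
    ℚ.∣ a ℚ.- c ∣ ℚ.≤ η → ℚ.∣ b ℚ.- d ∣ ℚ.≤ η →
    ℚ.∣ a ℚ.* b ℚ.- c ℚ.* d ∣ ℚ.≤ η ℚ.* B ℚ.+ η ℚ.* B
  product-close a b c d {B} {η} 0≤η ∣a∣≤B ∣d∣≤B ∣a-c∣≤η ∣b-d∣≤η = begin
    ℚ.∣ a ℚ.* b ℚ.- c ℚ.* d ∣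
      ≡⟨ cong ℚ.∣_∣ (solve 4
           (λ a b c d → a :* b :- c :* d := (b :- d) :* a :+ (a :- c) :* d) refl a b c d) ⟩
    ℚ.∣ (b ℚ.- d) ℚ.* a ℚ.+ (a ℚ.- c) ℚ.* d ∣
      ≤⟨ ℚ.∣p+q∣≤∣p∣+∣q∣ ((b ℚ.- d) ℚ.* a) ((a ℚ.- c) ℚ.* d) ⟩
    ℚ.∣ (b ℚ.- d) ℚ.* a ∣ ℚ.+ ℚ.∣ (a ℚ.- c) ℚ.* d ∣
      ≡⟨ cong₂ ℚ._+_ (ℚ.∣p*q∣≡∣p∣*∣q∣ (b ℚ.- d) a) (ℚ.∣p*q∣≡∣p∣*∣q∣ (a ℚ.- c) d) ⟩
    ℚ.∣ b ℚ.- d ∣ ℚ.* ℚ.∣ a ∣ ℚ.+ ℚ.∣ a ℚ.- c ∣ ℚ.* ℚ.∣ d ∣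
      ≤⟨ ℚ.+-mono-≤ (*-mono (ℚ.0≤∣p∣ a) 0≤η ∣b-d∣≤η ∣a∣≤B)
                    (*-mono (ℚ.0≤∣p∣ d) 0≤η ∣a-c∣≤η ∣d∣≤B) ⟩
    η ℚ.* B ℚ.+ η ℚ.* B ∎
    where
    open ℚ.≤-Reasoning
    open +-*-Solver

  p≤p+q : ∀ p {q} → 0ℚ ℚ.≤ q → p ℚ.≤ p ℚ.+ q
  p≤p+q p {q} 0≤q = subst (ℚ._≤ p ℚ.+ q) (ℚ.+-identityʳ p) (ℚ.+-monoʳ-≤ p {0ℚ} {q} 0≤q)

  p≤q+p : ∀ p {q} → 0ℚ ℚ.≤ q → p ℚ.≤ q ℚ.+ p
  p≤q+p p {q} 0≤q = subst (p ℚ.≤_) (ℚ.+-comm p q) (p≤p+q p 0≤q)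

  common-bound : ∀ {x y A B M N} → 0ℚ ℚ.< A → 0ℚ ℚ.< B →
    EventuallyBounded x A M → EventuallyBounded y B N →
    EventuallyBounded x (A ℚ.+ B) (M ℕ.⊔ N) × EventuallyBounded y (A ℚ.+ B) (M ℕ.⊔ N)
  common-bound {A = A} {B} {M} {N} 0<A 0<B a b =
    (λ m p → ℚ.≤-trans (a m (ℕ.m⊔n≤o⇒m≤o M N p)) (p≤p+q A (ℚ.<⇒≤ 0<B))) ,
    (λ m p → ℚ.≤-trans (b m (ℕ.m⊔n≤o⇒n≤o M N p)) (p≤q+p B (ℚ.<⇒≤ 0<A)))

  CloseAfter : (ℕ → ℚ) → ℚ → ℕ → Set
  CloseAfter x ε N = ∀ m n → N ℕ.≤ m → N ℕ.≤ n → ℚ.∣ x m ℚ.- x n ∣ ℚ.≤ ε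

  product-closeAfter : ∀ x y {B η M N O} → 0ℚ ℚ.≤ η →
    EventuallyBounded x B M × EventuallyBounded y B M → CloseAfter x η N → CloseAfter y η O →
    CloseAfter (λ m → x m ℚ.* y m) (η ℚ.* B ℚ.+ η ℚ.* B) (M ℕ.⊔ (N ℕ.⊔ O))
  product-closeAfter x y {M = M} {N} {O} 0≤η (a , b) f g m n p q =
    product-close (x m) (y m) (x n) (y n) 0≤η
      (a m (ℕ.m⊔n≤o⇒m≤o M (N ℕ.⊔ O) p))
      (b n (ℕ.m⊔n≤o⇒m≤o M (N ℕ.⊔ O) q))
      (f m n (ℕ.m⊔n≤o⇒m≤o N O p′) (ℕ.m⊔n≤o⇒m≤o N O q′))
      (g m n (ℕ.m⊔n≤o⇒n≤o N O p′) (ℕ.m⊔n≤o⇒n≤o N O q′))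
    where
    p′ = ℕ.m⊔n≤o⇒n≤o M (N ℕ.⊔ O) p
    q′ = ℕ.m⊔n≤o⇒n≤o M (N ℕ.⊔ O) q

  product-cauchy : ∀ x y → IsCauchy x → IsCauchy y → IsCauchy (λ m → x m ℚ.* y m)
  product-cauchy x y cx cy ε 0<ε = bounded (eventually-bounded {x} cx) (eventually-bounded {y} cy)
    where
    Goal : Set
    Goal = ∃[ N ] CloseAfter (λ m → x m ℚ.* y m) ε N

    conclude : ∀ {B η M} → 0ℚ ℚ.< η → η ℚ.* B ≡ ½ ℚ.* ε →
      EventuallyBounded x B M × EventuallyBounded y B M →
      ∃ (CloseAfter x η) → ∃ (CloseAfter y η) → Goal
    conclude {B} {η} {M} 0<η ηB b (N , f) (O , g) = M ℕ.⊔ (N ℕ.⊔ O) ,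
      subst (λ t → CloseAfter (λ m → x m ℚ.* y m) t (M ℕ.⊔ (N ℕ.⊔ O)))
        (trans (cong₂ ℚ._+_ ηB ηB) (half+half ε))
        (product-closeAfter x y {B} {η} (ℚ.<⇒≤ 0<η) b f g)

    choose : ∀ {B M} → EventuallyBounded x B M × EventuallyBounded y B M →
      ∃[ η ] (0ℚ ℚ.< η × η ℚ.* B ≡ ½ ℚ.* ε) → Goal
    choose {B} b (η , 0<η , ηB) = conclude {B} {η} 0<η ηB b (cx η 0<η) (cy η 0<η)

    bounded : ∃[ A ] ∃[ M ] (0ℚ ℚ.< A × EventuallyBounded x A M) →
      ∃[ B ] ∃[ N ] (0ℚ ℚ.< B × EventuallyBounded y B N) → Goal
    bounded (A , M , 0<A , a) (B , N , 0<B , b) = choose {A ℚ.+ B}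
      (common-bound {x} {y} {A} {B} 0<A 0<B a b)
      (shrink 0<ε (ℚ.<-≤-trans 0<A (p≤p+q A (ℚ.<⇒≤ 0<B))))

_*_ : ℝ → ℝ → ℝ
mkℝ x cx * mkℝ y cy = mkℝ (λ m → x m ℚ.* y m) (product-cauchy x y cx cy)

-- A sequence apart from 0 may still vanish at finitely many indices.
recip : ℚ → ℚ
recip q with q ℚ.≟ 0ℚ
... | yes _  = 0ℚ
... | no q≢0 = (ℚ.1/ q) {{ℚ.≢-nonZero q≢0}}

private
  recip-inverse : ∀ q → q ≢ 0ℚ → q ℚ.* recip q ≡ 1ℚ
  recip-inverse q q≢0 with q ℚ.≟ 0ℚ
  ... | yes q≡0  = contradiction q≡0 q≢0
  ... | no  q≢0′ = ℚ.*-inverseʳ q {{ℚ.≢-nonZero q≢0′}}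

  recip-difference : ∀ a b → a ≢ 0ℚ → b ≢ 0ℚ →
    (a ℚ.* b) ℚ.* (recip a ℚ.- recip b) ≡ b ℚ.- a
  recip-difference a b a≢0 b≢0 = begin
    (a ℚ.* b) ℚ.* (recip a ℚ.- recip b)
      ≡⟨ solve 4 (λ a b i j → (a :* b) :* (i :- j) := b :* (a :* i) :- a :* (b :* j)) refl
           a b (recip a) (recip b) ⟩
    b ℚ.* (a ℚ.* recip a) ℚ.- a ℚ.* (b ℚ.* recip b)
      ≡⟨ cong₂ (λ s t → b ℚ.* s ℚ.- a ℚ.* t) (recip-inverse a a≢0) (recip-inverse b b≢0) ⟩
    b ℚ.* 1ℚ ℚ.- a ℚ.* 1ℚ
      ≡⟨ cong₂ ℚ._-_ (ℚ.*-identityʳ b) (ℚ.*-identityʳ a) ⟩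
    b ℚ.- a ∎
    where
    open ≡-Reasoning
    open +-*-Solver

  apart⇒≢0 : ∀ {c q} → 0ℚ ℚ.< c → c ℚ.≤ ℚ.∣ q ∣ → q ≢ 0ℚ
  apart⇒≢0 0<c c≤ refl = ℚ.<-irrefl refl (ℚ.<-≤-trans 0<c c≤)

inverse : (x : ℝ) → x #0 → ℝ
inverse (mkℝ x cx) (mk#0 c 0<c M apart) = mkℝ (recip ∘ x) c⁻¹
  where
  instance
    posc² : ℚ.Positive (c ℚ.* c)
    posc² = ℚ.positive (*-pos 0<c 0<c)
  c⁻¹ : IsCauchy (recip ∘ x)
  c⁻¹ ε 0<ε with cx ((c ℚ.* c) ℚ.* ε) (*-pos (*-pos 0<c 0<c) 0<ε)
  ... | N , f = M ℕ.⊔ N , λ m n p q →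
    let a = x m ; b = x n ; r = recip a ℚ.- recip b
        c≤a = apart m (ℕ.m⊔n≤o⇒m≤o M N p)
        c≤b = apart n (ℕ.m⊔n≤o⇒m≤o M N q)
    in ℚ.*-cancelˡ-≤-pos (c ℚ.* c) (ℚ.≤-trans
      (ℚ.*-monoʳ-≤-nonNeg ℚ.∣ r ∣ {{ℚ.∣-∣-nonNeg r}}
        (*-mono (ℚ.<⇒≤ 0<c) (ℚ.0≤∣p∣ a) c≤a c≤b))
      (ℚ.≤-trans (ℚ.≤-reflexive (trans
        (sym (trans (ℚ.∣p*q∣≡∣p∣*∣q∣ (a ℚ.* b) r) (cong (ℚ._* ℚ.∣ r ∣) (ℚ.∣p*q∣≡∣p∣*∣q∣ a b))))
        (cong ℚ.∣_∣ (recip-difference a b (apart⇒≢0 0<c c≤a) (apart⇒≢0 0<c c≤b)))))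
      (f n m (ℕ.m⊔n≤o⇒n≤o M N q) (ℕ.m⊔n≤o⇒n≤o M N p))))

_÷_ : (x y : ℝ) {{_ : y #0}} → ℝ
_÷_ x y {{y#0}} = x * inverse y y#0

largest : {P : ℕ → Set} → Decidable P → ℕ → ℕ
largest P? zero    = zero
largest P? (suc b) = if does (P? (suc b)) then suc b else largest P? b

largest-satisfies : ∀ {P : ℕ → Set} (P? : Decidable P) b → P 0 → P (largest P? b)
largest-satisfies P? zero    p0 = p0
largest-satisfies P? (suc b) p0 with P? (suc b)
... | yes p = p
... | no  _ = largest-satisfies P? b p0

largest-upper : ∀ {P : ℕ → Set} (P? : Decidable P) b {a} → a ℕ.≤ b → P a → a ℕ.≤ largest P? b
largest-upper P? zero    a≤b p = a≤b
largest-upper P? (suc b) a≤b p with P? (suc b) | ℕ.m≤n⇒m<n∨m≡n a≤b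
... | yes _ | _               = a≤b
... | no ¬p | inj₁ (s≤s a≤b′) = largest-upper P? b a≤b′ p
... | no ¬p | inj₂ refl       = contradiction p ¬p

-- Below k q m a says (a / (m+1))^k ≤ q, for q ≥ 0. The k-th root of q is the limit of a / (m+1),
-- a being the largest such number; it is at most |↥ q| (m+1)^k. A negative q is replaced by |q|.
Below : ℕ → ℚ → ℕ → ℕ → Set
Below k q m a = a ^ k ℕ.* ↧ₙ q ℕ.≤ ℤ.∣ ↥ q ∣ ℕ.* suc m ^ k

below? : ∀ k q m → Decidable (Below k q m)
below? k q m a = a ^ k ℕ.* ↧ₙ q ℕ.≤? ℤ.∣ ↥ q ∣ ℕ.* suc m ^ k

rootNumerator : ℕ → ℚ → ℕ → ℕ
rootNumerator k q m = largest (below? k q m) (ℤ.∣ ↥ q ∣ ℕ.* suc m ^ k)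

private
  a≤a^k : ∀ a k .{{_ : NonZero k}} → a ℕ.≤ a ^ k
  a≤a^k zero    k       = z≤n
  a≤a^k (suc a) (suc k) = ℕ.m≤m*n (suc a) (suc a ^ k) {{ℕ.m^n≢0 (suc a) k}}

  *-^ : ∀ a b k → (a ℕ.* b) ^ k ≡ a ^ k ℕ.* b ^ k
  *-^ a b zero    = refl
  *-^ a b (suc k) = trans (cong (a ℕ.* b ℕ.*_) (*-^ a b k))
    (ℕ.[m*n]*[o*p]≡[m*o]*[n*p] a b (a ^ k) (b ^ k))

rootNumerator-below : ∀ k .{{_ : NonZero k}} q m → Below k q m (rootNumerator k q m)
rootNumerator-below (suc k) q m = largest-satisfies (below? (suc k) q m) (ℤ.∣ ↥ q ∣ ℕ.* suc m ^ suc k) z≤n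

rootNumerator-above : ∀ k .{{_ : NonZero k}} q m → ¬ Below k q m (suc (rootNumerator k q m))
rootNumerator-above k q m p = ℕ.<-irrefl refl
  (largest-upper (below? k q m) _
    (ℕ.≤-trans (a≤a^k _ k) (ℕ.≤-trans (ℕ.m≤m*n _ (↧ₙ q)) p)) p)

private
  root-close : ∀ k .{{_ : NonZero k}} q m n →
    rootNumerator k q m ℕ.* suc n ℕ.≤ suc (rootNumerator k q n) ℕ.* suc m
  root-close k q m n = ℕ.<⇒≤ (ℕ.≰⇒> λ le → ℕ.<-irrefl refl (lt le))
    where
    open ℕ.≤-Reasoning
    a = rootNumerator k q m
    b = suc (rootNumerator k q n)
    p = ℤ.∣ ↥ q ∣
    d = ↧ₙ q
    M = suc m ^ k
    N = suc n ^ k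
    swap : ∀ x y z → x ℕ.* y ℕ.* z ≡ x ℕ.* z ℕ.* y
    swap x y z = trans (ℕ.*-assoc x y z) (trans (cong (x ℕ.*_) (ℕ.*-comm y z)) (sym (ℕ.*-assoc x z y)))
    lt : b ℕ.* suc m ℕ.≤ a ℕ.* suc n → p ℕ.* M ℕ.* N ℕ.< p ℕ.* M ℕ.* N
    lt le = begin-strict
      p ℕ.* M ℕ.* N           ≡⟨ swap p M N ⟩
      p ℕ.* N ℕ.* M           <⟨ ℕ.*-monoˡ-< M {{ℕ.m^n≢0 (suc m) k}} (ℕ.≰⇒> (rootNumerator-above k q n)) ⟩
      b ^ k ℕ.* d ℕ.* M       ≡⟨ swap (b ^ k) d M ⟩
      b ^ k ℕ.* M ℕ.* d       ≡⟨ cong (ℕ._* d) (sym (*-^ b (suc m) k)) ⟩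
      (b ℕ.* suc m) ^ k ℕ.* d ≤⟨ ℕ.*-monoˡ-≤ d (ℕ.^-monoˡ-≤ k le) ⟩
      (a ℕ.* suc n) ^ k ℕ.* d ≡⟨ cong (ℕ._* d) (*-^ a (suc n) k) ⟩
      a ^ k ℕ.* N ℕ.* d       ≡⟨ swap (a ^ k) N d ⟩
      a ^ k ℕ.* d ℕ.* N       ≤⟨ ℕ.*-monoˡ-≤ N (rootNumerator-below k q m) ⟩
      p ℕ.* M ℕ.* N           ∎

root : (k : ℕ) .{{_ : NonZero k}} → ℚ → ℝ
root k q = mkℝ r (cauchy-from 1 r λ m n → ℚ.≤-trans
  (/-mono-ℕ (a m) (a n ℕ.+ 1) (suc m) (suc n)
    (subst (λ t → a m ℕ.* suc n ℕ.≤ t ℕ.* suc m) (ℕ.+-comm 1 (a n)) (root-close k q m n)))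
  (ℚ.≤-reflexive (sym (/-+ (a n) 1 (suc n)))))
  where
  a = rootNumerator k q
  r : ℕ → ℚ
  r m = + a m / suc m

-- Σ_{i ≤ m} 1/i!
partialSum : ℕ → ℚ
partialSum zero    = 1ℚ
partialSum (suc m) = partialSum m ℚ.+ (+ 1 / (suc m !)) {{suc m !≢0}}

private
  0≤1/ : ∀ d .{{_ : NonZero d}} → 0ℚ ℚ.≤ + 1 / d
  0≤1/ d = /-mono-ℕ 0 1 1 d z≤n

  n+2≤3n! : ∀ n → suc (suc n) ℕ.≤ 3 ℕ.* n !
  n+2≤3n! zero    = s≤s (s≤s z≤n)
  n+2≤3n! (suc n) = begin
    3 ℕ.+ n                 ≤⟨ ℕ.+-monoʳ-≤ 3 (ℕ.m≤n*m n 3) ⟩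
    3 ℕ.+ 3 ℕ.* n           ≡⟨ sym (ℕ.*-suc 3 n) ⟩
    3 ℕ.* suc n             ≤⟨ ℕ.*-monoʳ-≤ 3 (ℕ.m≤m*n (suc n) (n !) {{n !≢0}}) ⟩
    3 ℕ.* (suc n ℕ.* n !)   ∎
    where open ℕ.≤-Reasoning

  term-bound : ∀ n →
    (+ 1 / (suc n !)) {{suc n !≢0}} ℚ.+ + 3 / suc (suc n) ℚ.≤ + 3 / suc n
  term-bound n = begin
    (+ 1 / (suc n !)) {{suc n !≢0}} ℚ.+ + 3 / suc (suc n)
      ≤⟨ ℚ.+-mono-≤
           (/-mono-ℕ 1 3 (suc n !) D {{suc n !≢0}} term≤)
           (/-mono-ℕ 3 (3 ℕ.* suc n) (suc (suc n)) D
             (ℕ.≤-reflexive (sym (ℕ.*-assoc 3 (suc n) (suc (suc n)))))) ⟩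
    + 3 / D ℚ.+ + (3 ℕ.* suc n) / D
      ≡⟨ /-+ 3 (3 ℕ.* suc n) D ⟩
    + (3 ℕ.+ 3 ℕ.* suc n) / D
      ≤⟨ /-mono-ℕ (3 ℕ.+ 3 ℕ.* suc n) 3 D (suc n) (ℕ.≤-reflexive total) ⟩
    + 3 / suc n ∎
    where
    open ℚ.≤-Reasoning
    D = suc n ℕ.* suc (suc n)
    term≤ : 1 ℕ.* D ℕ.≤ 3 ℕ.* (suc n ℕ.* n !)
    term≤ = ℕ.≤-trans (ℕ.≤-reflexive (ℕ.*-identityˡ D))
      (ℕ.≤-trans (ℕ.*-monoʳ-≤ (suc n) (n+2≤3n! n))
      (ℕ.≤-reflexive (trans (sym (ℕ.*-assoc (suc n) 3 (n !)))
        (trans (cong (ℕ._* n !) (ℕ.*-comm (suc n) 3)) (ℕ.*-assoc 3 (suc n) (n !))))))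
    total : (3 ℕ.+ 3 ℕ.* suc n) ℕ.* suc n ≡ 3 ℕ.* D
    total = trans (cong (ℕ._* suc n) (sym (ℕ.*-suc 3 (suc n))))
      (trans (ℕ.*-assoc 3 (suc (suc n)) (suc n)) (cong (3 ℕ.*_) (ℕ.*-comm (suc (suc n)) (suc n))))

  partialSum-step : ∀ n → partialSum n ℚ.≤ partialSum (suc n)
  partialSum-step n = p≤p+q (partialSum n) (0≤1/ (suc n !) {{suc n !≢0}})

  partialSum-mono : ∀ {m n} → m ℕ.≤′ n → partialSum m ℚ.≤ partialSum n
  partialSum-mono (ℕ.≤′-reflexive refl)  = ℚ.≤-refl
  partialSum-mono {n = suc n} (ℕ.≤′-step m≤n) = ℚ.≤-trans (partialSum-mono m≤n) (partialSum-step n)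

  partialSum-tail : ∀ {m n} → n ℕ.≤′ m →
    partialSum m ℚ.+ + 3 / suc m ℚ.≤ partialSum n ℚ.+ + 3 / suc n
  partialSum-tail (ℕ.≤′-reflexive refl)  = ℚ.≤-refl
  partialSum-tail {suc m} {n} (ℕ.≤′-step n≤m) = ℚ.≤-trans
    (ℚ.≤-reflexive (ℚ.+-assoc (partialSum m) _ _))
    (ℚ.≤-trans (ℚ.+-monoʳ-≤ (partialSum m) (term-bound m)) (partialSum-tail n≤m))

  weaken : ∀ p m → p ℚ.≤ p ℚ.+ + 3 / suc m
  weaken p m = p≤p+q p (/-mono-ℕ 0 3 1 (suc m) z≤n)

  partialSum-close : ∀ m n → partialSum m ℚ.≤ partialSum n ℚ.+ + 3 / suc n
  partialSum-close m n with ℕ.≤-total m n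
  ... | inj₁ m≤n = ℚ.≤-trans (partialSum-mono (ℕ.≤⇒≤′ m≤n)) (weaken (partialSum n) n)
  ... | inj₂ n≤m = ℚ.≤-trans (weaken (partialSum m) m) (partialSum-tail (ℕ.≤⇒≤′ n≤m))

e : ℝ
e = mkℝ partialSum (cauchy-from 3 partialSum partialSum-close)

instance
  e#0 : e #0
  e#0 = mk#0 1ℚ (ℚ.positive⁻¹ 1ℚ) 0 λ m _ →
    ℚ.≤-trans (partialSum-mono (ℕ.≤⇒≤′ (z≤n {m}))) (p≤∣p∣ (partialSum m))

{-# OPTIONS --safe #-}

-- Let A ⊆ [0,n] be a B_k-sequence with N elements. Signs for k elements of A whose partial sums
-- stay within [-δ,δ] give a signed sum Σ ±a, which by Abel summation lies in an interval of
-- 2δn + 1 integers. If all signs add up to the same number, equal signed sums P - M = P′ - M′ give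
-- the B_k-relation P + M′ = P′ + M, so distinct choices have distinct signed sums; for odd k one
-- end of the interval is not attained. With the deviation sets as sign patterns this shows
-- ζ(k,δ) C(N,k) ≤ δ(1+τ)n. If N < k, the patterns are cut off after N signs, which costs
-- a factor of at most 2^(k-N).
--
-- The passage to k-th roots uses N(N-1)⋯(N-k+1) ≥ (N - k + k/E)^k for partial sums E of e. By
-- induction on k this amounts to (1 + 1/(z-1))^(k-1) ≤ 1 + (E-1) k/z for z = E (N - k + k/E) ≥ k.

module Submission where

open import Data.Fin using (Fin; toℕ) renaming (zero to fzero; suc to fsuc)
open import Data.Fin.Subset using (Subset; inside; outside; ∣_∣) renaming (_∈_ to _∈ˢ_)
open import Data.Fin.Subset.Properties using (nonempty?; Empty-unique; ∣⊥∣≡0)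
open import Data.Integer as ℤ using (ℤ)
import Data.Integer.GCD as ℤ
import Data.Integer.Properties as ℤ
import Data.Integer.Tactic.RingSolver as ℤ
open import Data.List as List using (List; []; _∷_; _++_; length; map; replicate; take; upTo; applyUpTo; concatMap)
open import Data.List.Extrema.Nat using (argmax-all)
open import Data.List.Membership.Propositional using (_∈_; find)
open import Data.List.Membership.Propositional.Properties
  using (∈-∃++; ∈-map⁺; ∈-map⁻; ∈-++⁺ˡ; ∈-++⁺ʳ; ∈-++⁻; ∈-applyUpTo⁺; ∈-filter⁻; ∈-concatMap⁻)
open import Data.List.Properties using (length-++; length-map; length-replicate; length-applyUpTo; map-++; map-replicate; map-∘)
open import Data.List.Relation.Binary.Disjoint.Propositional using (Disjoint)
open import Data.List.Relation.Binary.Permutation.Propositional using (_↭_)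
open import Data.List.Relation.Binary.Permutation.Propositional.Properties using () renaming (map⁺ to ↭-map⁺)
open import Data.List.Relation.Unary.All as All using (All; []; _∷_)
import Data.List.Relation.Unary.All.Properties as All
open import Data.List.Relation.Unary.AllPairs as AllPairs using ([]; _∷_)
import Data.List.Relation.Unary.AllPairs.Properties as AllPairs
open import Data.List.Relation.Unary.Any using (here; there)
open import Data.List.Relation.Unary.Unique.Propositional using (Unique)
import Data.List.Relation.Unary.Unique.Propositional.Properties as Unique
open import Data.Nat.Combinatorics using (_C_; nCk+nC[k+1]≡[n+1]C[k+1]; nCk≡n!/k![n-k]!; k![n∸k]!∣n!; nCn≡1)
open import Data.Nat.DivMod using (m/n*n≡m; m%n<n; [m+kn]%n≡m%n)
open import Data.Nat.ListAction using (sum)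
open import Data.Nat.ListAction.Properties using (sum-++; sum-↭)
open import Data.Nat.Tactic.RingSolver using (solve-∀)
open import Data.Product using (∃-syntax; _,_; _×_; proj₁; proj₂)
import Data.Rational.Properties as ℚ
open import Data.Rational.Solver using (module +-*-Solver)
open import Data.Rational.Unnormalised as ℚᵘ using (mkℚᵘ)
import Data.Rational.Unnormalised.Properties as ℚᵘ
open import Data.Sum using (_⊎_; inj₁; inj₂)
open import Data.Vec as Vec using (Vec; []; _∷_; here; there)
open import Data.Vec.Properties using (toList∘fromList)
import Data.Vec.Relation.Unary.All.Properties as VecAll
open import Function using (_∘_; const; id)
open import Relation.Binary.PropositionalEquality
open import Relation.Nullary using (Dec; yes; no; contradiction)

-- A deviation set lists the run lengths of a walk of k steps ±1 that begins upwards. Shifted by δ,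
-- the walk stays in [0, 2δ], starts at δ and ends at δ if k is even, at δ - 1 or δ + 1 if k is odd.
-- The B_k-relation only compares walks with a common end, and reflection in δ provides it. For even
-- k the reflected walks are new and have the same end, so 2 ζ(k,δ) C(N,k) distinct values lie among
-- 2δn + 1 integers, and halving removes the 1. For odd k the reflection is spent on moving the end
-- δ + 1 to δ - 1; there is no doubling, whence 1 + τ.
--
-- The number e enters through convexity: for j = k - 1 ≥ 1 the power (1 + 1/(z-1))^j is at most the
-- exponential series cut off at degree j, taken at j/(z-1) ≤ 1, and on [0,1] that series lies below
-- a chord of slope at most E - 1. Partial sums keep this inside the natural numbers, and E ≤ e
-- gives 1 - 1/E ≤ 1 - 1/e at the end.
--
-- If N < k, each missing element lowers N - k + k/E by 1. As long as this stays nonnegative, its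
-- k-th power shrinks at least by a factor 3 each time, which outweighs the loss in the count.

-- Powers, truncated exponentials and falling factorials

module Inequalities where

  open import Data.Nat
  open import Data.Nat.Properties
  open import Algebra.Properties.CommutativeSemigroup *-commutativeSemigroup using () renaming (x∙yz≈y∙xz to *-swap)

  bernoulli : ∀ x v l → x ^ suc l + suc l * v * x ^ l ≤ (x + v) ^ suc l
  bernoulli x v zero    = ≤-reflexive (eq x v)
    where
    eq : ∀ x v → x * 1 + (v + 0) * 1 ≡ (x + v) * 1
    eq = solve-∀
  bernoulli x v (suc l) = begin
    x * (x * p) + (2 + l) * v * (x * p)
      ≤⟨ m≤m+n _ (v * (suc l * v * p)) ⟩
    x * (x * p) + (2 + l) * v * (x * p) + v * (suc l * v * p)
      ≡⟨ factor x v l p ⟩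
    (x + v) * (x * p + suc l * v * p)
      ≤⟨ *-monoʳ-≤ (x + v) (bernoulli x v l) ⟩
    (x + v) * (x + v) ^ suc l ∎
    where
    open ≤-Reasoning
    p = x ^ l
    factor : ∀ x v l p → x * (x * p) + (2 + l) * v * (x * p) + v * (suc l * v * p) ≡
      (x + v) * (x * p + suc l * v * p)
    factor = solve-∀

  -- l! (1/1! + … + 1/l!)
  expTail : ℕ → ℕ
  expTail zero    = 0
  expTail (suc l) = suc l * expTail l + 1

  -- l! u^l Σ_{i ≤ l} (x/u)^i / i!
  truncExp : ℕ → ℕ → ℕ → ℕ
  truncExp u zero    x = 1
  truncExp u (suc l) x = suc l * u * truncExp u l x + x ^ suc l

  -- Tangent-line bound: `truncExp u (suc l)` has the derivative `suc l * truncExp u l` and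
  -- nonnegative coefficients.
  truncExp-shift : ∀ u l x v →
    truncExp u (suc l) x + suc l * v * truncExp u l x ≤ truncExp u (suc l) (x + v)
  truncExp-shift u zero    x v = ≤-reflexive (eq u x v)
    where
    eq : ∀ u x v → (u + 0) * 1 + x * 1 + (v + 0) * 1 ≡ (u + 0) * 1 + (x + v) * 1
    eq = solve-∀
  truncExp-shift u (suc l) x v = begin
    (2 + l) * u * T + x ^ (2 + l) + (2 + l) * v * (suc l * u * t + x ^ suc l)
      ≡⟨ rearrange u l v (x ^ suc l) (x ^ (2 + l)) t ⟩
    (2 + l) * u * (T + suc l * v * t) + (x ^ (2 + l) + (2 + l) * v * x ^ suc l)
      ≤⟨ +-mono-≤ (*-monoʳ-≤ ((2 + l) * u) (truncExp-shift u l x v)) (bernoulli x v (suc l)) ⟩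
    truncExp u (2 + l) (x + v) ∎
    where
    open ≤-Reasoning
    t = truncExp u l x
    T = truncExp u (suc l) x
    rearrange : ∀ u l v p q t → (2 + l) * u * (suc l * u * t + p) + q + (2 + l) * v * (suc l * u * t + p) ≡
      (2 + l) * u * (suc l * u * t + p + suc l * v * t) + (q + (2 + l) * v * p)
    rearrange = solve-∀

  -- Each new factor u + v is paid for by one tangent step of length v. Divided by j! u^j, this is
  -- (1 + v/u)^j ≤ Σ_{i ≤ j} (jv/u)^i / i!.
  pow≤truncExp : ∀ u v j → j ! * (u + v) ^ j ≤ truncExp u j (j * v)
  pow≤truncExp u v zero    = ≤-refl
  pow≤truncExp u v (suc j) = begin
    suc j * j ! * ((u + v) * (u + v) ^ j)
      ≡⟨ rearrange j u v (j !) ((u + v) ^ j) ⟩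
    suc j * (u + v) * (j ! * (u + v) ^ j)
      ≤⟨ *-monoʳ-≤ (suc j * (u + v)) (pow≤truncExp u v j) ⟩
    suc j * (u + v) * t
      ≡⟨ distribute u v j t ⟩
    suc j * u * t + suc j * v * t
      ≤⟨ +-monoˡ-≤ (suc j * v * t) (m≤m+n (suc j * u * t) ((j * v) ^ suc j)) ⟩
    truncExp u (suc j) (j * v) + suc j * v * t
      ≤⟨ truncExp-shift u j (j * v) v ⟩
    truncExp u (suc j) (j * v + v)
      ≡⟨ cong (truncExp u (suc j)) (+-comm (j * v) v) ⟩
    truncExp u (suc j) (suc j * v) ∎
    where
    open ≤-Reasoning
    t = truncExp u j (j * v)
    rearrange : ∀ j u v f p → suc j * f * ((u + v) * p) ≡ suc j * (u + v) * (f * p)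
    rearrange = solve-∀
    distribute : ∀ u v j t → suc j * (u + v) * t ≡ suc j * u * t + suc j * v * t
    distribute = solve-∀

  -- By convexity, a truncated exponential lies below its chord on [0,1].
  truncExp≤chord : ∀ {u x} l → x ≤ u → truncExp u l x * u ≤ u ^ l * (l ! * u + x * expTail l)
  truncExp≤chord {u} {x} zero    x≤u = ≤-reflexive (eq u x)
    where
    eq : ∀ u x → 1 * u ≡ 1 * (1 * u + x * 0)
    eq = solve-∀
  truncExp≤chord {u} {x} (suc l) x≤u = begin
    (suc l * u * truncExp u l x + x * x ^ l) * u
      ≡⟨ rearrange l u x (truncExp u l x) (x ^ l) ⟩
    suc l * u * (truncExp u l x * u) + x * u * x ^ l
      ≤⟨ +-mono-≤ (*-monoʳ-≤ (suc l * u) (truncExp≤chord l x≤u))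
                  (*-monoʳ-≤ (x * u) (^-monoˡ-≤ l x≤u)) ⟩
    suc l * u * (u ^ l * (l ! * u + x * expTail l)) + x * u * u ^ l
      ≡⟨ collect l u x (u ^ l) (l !) (expTail l) ⟩
    u * u ^ l * (suc l * l ! * u + x * (suc l * expTail l + 1)) ∎
    where
    open ≤-Reasoning
    rearrange : ∀ l u x t p → (suc l * u * t + x * p) * u ≡ suc l * u * (t * u) + x * u * p
    rearrange = solve-∀
    collect : ∀ l u x p f K → suc l * u * (p * (f * u + x * K)) + x * u * p ≡
      u * p * (suc l * f * u + x * (suc l * K + 1))
    collect = solve-∀

  -- The chord slopes `expTail l` / l! increase with l, so the slope for L serves all exponents j ≤
  -- L.
  expTail-mono : ∀ {j L} → j ≤′ L → expTail j * L ! ≤ expTail L * j !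
  expTail-mono (≤′-reflexive refl) = ≤-refl
  expTail-mono {j} {suc L} (≤′-step j≤L) = begin
    expTail j * (suc L * L !)           ≡⟨ *-swap (expTail j) (suc L) (L !) ⟩
    suc L * (expTail j * L !)           ≤⟨ *-monoʳ-≤ (suc L) (expTail-mono j≤L) ⟩
    suc L * (expTail L * j !)           ≡⟨ *-assoc (suc L) (expTail L) (j !) ⟨
    suc L * expTail L * j !             ≤⟨ *-monoˡ-≤ (j !) (m≤m+n (suc L * expTail L) 1) ⟩
    (suc L * expTail L + 1) * j !       ∎
    where open ≤-Reasoning

  -- (1 + v/u)^j ≤ 1 + (j v/u) (1/1! + … + 1/L!), scaled by L! u^{j+1}.
  pow≤chord : ∀ {u v j L} → j ≤ L → j * v ≤ u →
    L ! * ((u + v) ^ j * u) ≤ u ^ j * (L ! * u + j * v * expTail L)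
  pow≤chord {u} {v} {j} {L} j≤L jv≤u = *-cancelˡ-≤ (j !) {{j !≢0}} (begin
    j ! * (L ! * ((u + v) ^ j * u))
      ≡⟨ rearrange u (j !) (L !) ((u + v) ^ j) ⟩
    L ! * (j ! * (u + v) ^ j * u)
      ≤⟨ *-monoʳ-≤ (L !) (*-monoˡ-≤ u (pow≤truncExp u v j)) ⟩
    L ! * (truncExp u j (j * v) * u)
      ≤⟨ *-monoʳ-≤ (L !) (truncExp≤chord j jv≤u) ⟩
    L ! * (u ^ j * (j ! * u + j * v * expTail j))
      ≡⟨ distribute u v j (j !) (L !) (u ^ j) (expTail j) ⟩
    u ^ j * (j ! * (L ! * u) + j * v * (expTail j * L !))
      ≤⟨ *-monoʳ-≤ (u ^ j) (+-monoʳ-≤ _ (*-monoʳ-≤ (j * v) (expTail-mono (≤⇒≤′ j≤L)))) ⟩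
    u ^ j * (j ! * (L ! * u) + j * v * (expTail L * j !))
      ≡⟨ collect u v j (j !) (L !) (u ^ j) (expTail L) ⟩
    j ! * (u ^ j * (L ! * u + j * v * expTail L)) ∎)
    where
    open ≤-Reasoning
    rearrange : ∀ u f F p → f * (F * (p * u)) ≡ F * (f * p * u)
    rearrange = solve-∀
    distribute : ∀ u v j f F p K → F * (p * (f * u + j * v * K)) ≡ p * (f * (F * u) + j * v * (K * F))
    distribute = solve-∀
    collect : ∀ u v j f F p K → p * (f * (F * u) + j * v * (K * f)) ≡ f * (p * (F * u + j * v * K))
    collect = solve-∀

  -- expNumerator L / L! is the L-th partial sum of e.
  expNumerator : ℕ → ℕ
  expNumerator L = L ! + expTail L

  -- With E = G / L! and z = dE + j + 1 one has u = L! (z - 1) and u + L! = L! z, so this is the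
  -- inequality for z with k = j + 1, cleared of denominators. L is independent of j because the
  -- induction on k lowers j and has to keep E.
  factorial-step : ∀ {j L} d → j ≤ L →
    let G = expNumerator L ; u = d * G + j * L ! in
    (u + L !) ^ suc j ≤ u ^ j * (suc (d + j) * G)
  -- Here u vanishes for d = 0, so the division by u below is confined to j > 0.
  factorial-step {zero}  {L} d _ = begin
    (d * (F + K) + 0 + F) * 1 ≤⟨ m≤m+n _ K ⟩
    (d * (F + K) + 0 + F) * 1 + K ≡⟨ eq d F K ⟩
    1 * (suc (d + 0) * (F + K)) ∎
    where
    open ≤-Reasoning
    F = L !
    K = expTail L
    eq : ∀ d F K → (d * (F + K) + 0 + F) * 1 + K ≡ 1 * (suc (d + 0) * (F + K))
    eq = solve-∀
  factorial-step {j@(suc i)} {L} d j≤L = *-cancelʳ-≤ _ _ u {{u≢0}} (begin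
    (u + F) * (u + F) ^ j * u
      ≡⟨ *-assoc (u + F) ((u + F) ^ j) u ⟩
    (u + F) * ((u + F) ^ j * u)
      ≤⟨ *-monoʳ-≤ (u + F) chord ⟩
    (u + F) * (u ^ j * (u + j * K))
      ≡⟨ expand j u F K (u ^ j) ⟩
    u ^ j * (u * (u + F + j * K) + K * (j * F))
      -- The chord gave 1 + (E-1) j/(z-1). Since z ≥ j + 1, that is j L! ≤ u, this is at most 1 +
      -- (E-1) (j+1)/z.
      ≤⟨ *-monoʳ-≤ (u ^ j) (+-monoʳ-≤ _ (*-monoʳ-≤ K jF≤u)) ⟩
    u ^ j * (u * (u + F + j * K) + K * u)
      ≡⟨ collect d j F K (u ^ j) ⟩
    u ^ j * (suc (d + j) * (F + K)) * u ∎)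
    where
    open ≤-Reasoning
    F = L !
    K = expTail L
    u = d * (F + K) + j * F
    jF≤u : j * F ≤ u
    jF≤u = m≤n+m (j * F) (d * (F + K))
    u≢0 : NonZero u
    u≢0 = >-nonZero (≤-trans (n≢0⇒n>0 (≢-nonZero⁻¹ F {{L !≢0}})) (≤-trans (m≤m+n F (i * F)) jF≤u))
    chord : (u + F) ^ j * u ≤ u ^ j * (u + j * K)
    chord = *-cancelˡ-≤ F {{L !≢0}} (≤-trans (pow≤chord j≤L jF≤u) (≤-reflexive (eq j u F K (u ^ j))))
      where
      eq : ∀ j u F K p → p * (F * u + j * F * K) ≡ F * (p * (u + j * K))
      eq = solve-∀
    expand : ∀ j u F K p → (u + F) * (p * (u + j * K)) ≡ p * (u * (u + F + j * K) + K * (j * F))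
    expand = solve-∀
    collect : ∀ d j F K p →
      p * ((d * (F + K) + j * F) * (d * (F + K) + j * F + F + j * K) + K * (d * (F + K) + j * F)) ≡
      p * (suc (d + j) * (F + K)) * (d * (F + K) + j * F)
    collect = solve-∀

  -- (N - k + k/E)^k ≤ N (N-1) ⋯ (N-k+1) for N = d + k and E the L-th partial sum of e.
  pow≤factorial : ∀ k {L} d → k ≤ L →
    (d * expNumerator L + k * L !) ^ k * d ! ≤ expNumerator L ^ k * (d + k) !
  pow≤factorial zero    d _ = ≤-reflexive (cong (λ t → 1 * t !) (sym (+-identityʳ d)))
  pow≤factorial (suc j) {L} d 1+j≤L = begin
    (d * G + suc j * L !) ^ suc j * d !
      ≡⟨ cong (λ t → (d * G + t) ^ suc j * d !) (+-comm (L !) (j * L !)) ⟩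
    (d * G + (j * L ! + L !)) ^ suc j * d !
      ≡⟨ cong (λ t → t ^ suc j * d !) (+-assoc (d * G) (j * L !) (L !)) ⟨
    (u + L !) ^ suc j * d !
      ≤⟨ *-monoˡ-≤ (d !) (factorial-step {j} {L} d (<⇒≤ 1+j≤L)) ⟩
    u ^ j * (suc (d + j) * G) * d !
      ≡⟨ move (u ^ j) (suc (d + j)) G (d !) ⟩
    suc (d + j) * G * (u ^ j * d !)
      ≤⟨ *-monoʳ-≤ (suc (d + j) * G) (pow≤factorial j {L} d (<⇒≤ 1+j≤L)) ⟩
    suc (d + j) * G * (G ^ j * (d + j) !)
      ≡⟨ collect (suc (d + j)) G (G ^ j) ((d + j) !) ⟩
    G ^ suc j * suc (d + j) !
      ≡⟨ cong (λ t → G ^ suc j * t !) (+-suc d j) ⟨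
    G ^ suc j * (d + suc j) ! ∎
    where
    open ≤-Reasoning
    G = expNumerator L
    u = d * G + j * L !
    move : ∀ p s G f → p * (s * G) * f ≡ s * G * (p * f)
    move = solve-∀
    collect : ∀ s G p f → s * G * (p * f) ≡ G * p * (s * f)
    collect = solve-∀

  !≤expTail : ∀ l .{{_ : NonZero l}} → l ! ≤ expTail l
  !≤expTail (suc zero) = ≤-refl
  !≤expTail (suc l@(suc _)) = ≤-trans (*-monoʳ-≤ (suc l) (!≤expTail l)) (m≤m+n _ 1)

  -- By Bernoulli, raising w by G multiplies w^k at least by 3: w ≤ k L! and G ≥ 2 L! give 2w ≤ kG.
  -- In the application r is the number k - N of missing elements.
  pow-descent : ∀ k {L} .{{_ : NonZero k}} .{{_ : NonZero L}} r w → w + r * expNumerator L ≡ k * L ! →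
    3 ^ r * w ^ k ≤ (k * L !) ^ k
  pow-descent k zero    w eq rewrite sym eq | +-identityʳ w = ≤-reflexive (+-identityʳ (w ^ k))
  pow-descent k@(suc j) {L} (suc r) w eq = begin
    3 * 3 ^ r * (w * w ^ j)
      ≡⟨ move (3 ^ r) w (w ^ j) ⟩
    3 ^ r * (w * w ^ j + 2 * w * w ^ j)
      ≤⟨ *-monoʳ-≤ (3 ^ r) (+-monoʳ-≤ _ (*-monoˡ-≤ (w ^ j) 2w≤kG)) ⟩
    3 ^ r * (w ^ k + k * G * w ^ j)
      ≤⟨ *-monoʳ-≤ (3 ^ r) (bernoulli w G j) ⟩
    3 ^ r * (w + G) ^ k
      ≤⟨ pow-descent k {L} r (w + G) (trans (+-assoc w G (r * G)) eq) ⟩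
    (k * L !) ^ k ∎
    where
    open ≤-Reasoning
    G = expNumerator L
    move : ∀ t w p → 3 * t * (w * p) ≡ t * (w * p + 2 * w * p)
    move = solve-∀
    2w≤kG : 2 * w ≤ k * G
    2w≤kG = begin
      2 * w           ≤⟨ *-monoʳ-≤ 2 (≤-trans (m≤m+n w _) (≤-reflexive eq)) ⟩
      2 * (k * L !)   ≡⟨ double k (L !) ⟩
      k * (L ! + L !) ≤⟨ *-monoʳ-≤ k (+-monoʳ-≤ (L !) (!≤expTail L)) ⟩
      k * G           ∎
      where
      double : ∀ k f → 2 * (k * f) ≡ k * (f + f)
      double = solve-∀

-- Multisets, signed sums and the counting argument

module SignedSums where

  open import Defs using (IsB)
  open import Data.Nat
  open import Data.Nat.Properties
  open import Algebra.Properties.CommutativeSemigroup +-commutativeSemigroup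
    using (interchange) renaming (x∙yz≈y∙xz to +-swap)

  length-⊆ : ∀ {A : Set} {xs ys : List A} → Unique xs → (∀ {x} → x ∈ xs → x ∈ ys) → length xs ≤ length ys
  length-⊆ {xs = []} _ _ = z≤n
  length-⊆ {xs = x ∷ xs} (x∉xs ∷ u) xs⊆ys with ∈-∃++ (xs⊆ys (here refl))
  ... | ws , zs , refl = ≤-trans (s≤s (length-⊆ u remove)) (≤-reflexive (sym len))
    where
    len : length (ws ++ x ∷ zs) ≡ suc (length (ws ++ zs))
    len = trans (length-++ ws) (trans (+-suc (length ws) (length zs)) (cong suc (sym (length-++ ws))))
    remove : ∀ {y} → y ∈ xs → y ∈ ws ++ zs
    remove y∈xs with ∈-++⁻ ws (xs⊆ys (there y∈xs))
    ... | inj₁ y∈ws         = ∈-++⁺ˡ y∈ws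
    ... | inj₂ (here refl)  = contradiction refl (All.lookup x∉xs y∈xs)
    ... | inj₂ (there y∈zs) = ∈-++⁺ʳ ws y∈zs

  length-interval : ∀ {xs} lo w → Unique xs → All (λ x → lo ≤ x × x < lo + w) xs → length xs ≤ w
  length-interval {xs} lo w u bounds = subst (length xs ≤_) (length-applyUpTo (lo +_) w)
    (length-⊆ u λ {x} x∈xs → let lo≤x , x<hi = All.lookup bounds x∈xs in
      subst (_∈ applyUpTo (lo +_) w) (m+[n∸m]≡n lo≤x)
        (∈-applyUpTo⁺ (lo +_) (+-cancelˡ-< lo (x ∸ lo) w (subst (_< lo + w) (sym (m+[n∸m]≡n lo≤x)) x<hi))))

  map-unique : ∀ {A B : Set} {P : A → Set} {f : A → B} {xs} →
    (∀ {x y} → P x → P y → f x ≡ f y → x ≡ y) → All P xs → Unique xs → Unique (map f xs)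
  map-unique inj []         []         = []
  map-unique inj (px ∷ pxs) (x∉xs ∷ u) =
    All.map⁺ (All.zipWith (λ (x≢y , py) eq → x≢y (inj px py eq)) (x∉xs , pxs)) ∷ map-unique inj pxs u

  -- A vector of multiplicities xs stands for the multiset with xs_i copies of i.
  dot : ∀ {l} → (Fin l → ℕ) → Vec ℕ l → ℕ
  dot g []       = 0
  dot g (x ∷ xs) = x * g fzero + dot (g ∘ fsuc) xs

  dot-zero : ∀ {l} (xs : Vec ℕ l) → dot (const 0) xs ≡ 0
  dot-zero []       = refl
  dot-zero (x ∷ xs) = cong₂ _+_ (*-zeroʳ x) (dot-zero xs)

  -- Turns permutations into equal multiplicities: a permutation preserves the total of every weight
  -- g, and weights concentrated at one index read off the entries.
  dot-injective : ∀ {l} {xs ys : Vec ℕ l} → (∀ g → dot g xs ≡ dot g ys) → xs ≡ ys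
  dot-injective {xs = []}     {[]}     eq = refl
  dot-injective {xs = x ∷ xs} {y ∷ ys} eq = cong₂ _∷_
    (begin
      x                         ≡⟨ first x xs ⟨
      dot indicator (x ∷ xs)    ≡⟨ eq indicator ⟩
      dot indicator (y ∷ ys)    ≡⟨ first y ys ⟩
      y                         ∎)
    (dot-injective λ g → begin
      dot g xs                  ≡⟨ cong (_+ dot g xs) (*-zeroʳ x) ⟨
      dot (extend g) (x ∷ xs)   ≡⟨ eq (extend g) ⟩
      dot (extend g) (y ∷ ys)   ≡⟨ cong (_+ dot g ys) (*-zeroʳ y) ⟩
      dot g ys                  ∎)
    where
    open ≡-Reasoning
    indicator : ∀ {l} → Fin (suc l) → ℕ
    indicator fzero    = 1
    indicator (fsuc _) = 0
    first : ∀ {l} x (xs : Vec ℕ l) → dot indicator (x ∷ xs) ≡ x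
    first x xs = trans (cong₂ _+_ (*-identityʳ x) (dot-zero xs)) (+-identityʳ x)
    extend : ∀ {l} → (Fin l → ℕ) → Fin (suc l) → ℕ
    extend g fzero    = 0
    extend g (fsuc i) = g i

  -- The sum Σ i x_i of the multiset (see `dot-toℕ`), written as a sum of suffix sums, the form in
  -- which Abel summation produces it.
  moment : ∀ {l} → Vec ℕ l → ℕ
  moment []       = 0
  moment (x ∷ xs) = Vec.sum xs + moment xs

  dot-suc : ∀ {l} (g : Fin l → ℕ) xs → dot (suc ∘ g) xs ≡ Vec.sum xs + dot g xs
  dot-suc g []       = refl
  dot-suc g (x ∷ xs) = trans (cong (x * suc (g fzero) +_) (dot-suc (g ∘ fsuc) xs))
    (rearrange x (g fzero) (Vec.sum xs) (dot (g ∘ fsuc) xs))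
    where
    rearrange : ∀ x a s d → x * suc a + (s + d) ≡ x + s + (x * a + d)
    rearrange = solve-∀

  dot-toℕ : ∀ {l} (xs : Vec ℕ l) → dot toℕ xs ≡ moment xs
  dot-toℕ []       = refl
  dot-toℕ (x ∷ xs) = trans (cong (_+ dot (suc ∘ toℕ) xs) (*-zeroʳ x))
    (trans (dot-suc toℕ xs) (cong (Vec.sum xs +_) (dot-toℕ xs)))

  elements : ∀ {l} → Vec ℕ l → List (Fin l)
  elements []       = []
  elements (x ∷ xs) = replicate x fzero ++ map fsuc (elements xs)

  sum-replicate : ∀ n x → sum (replicate n x) ≡ n * x
  sum-replicate zero    x = refl
  sum-replicate (suc n) x = cong (x +_) (sum-replicate n x)

  sum-map-elements : ∀ {l} (g : Fin l → ℕ) xs → sum (map g (elements xs)) ≡ dot g xs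
  sum-map-elements g []       = refl
  sum-map-elements g (x ∷ xs) = begin
    sum (map g (replicate x fzero ++ map fsuc (elements xs)))
      ≡⟨ cong sum (map-++ g (replicate x fzero) _) ⟩
    sum (map g (replicate x fzero) ++ map g (map fsuc (elements xs)))
      ≡⟨ sum-++ (map g (replicate x fzero)) _ ⟩
    sum (map g (replicate x fzero)) + sum (map g (map fsuc (elements xs)))
      ≡⟨ cong₂ _+_ (trans (cong sum (map-replicate g x fzero)) (sum-replicate x (g fzero)))
           (trans (cong sum (sym (map-∘ (elements xs)))) (sum-map-elements (g ∘ fsuc) xs)) ⟩
    x * g fzero + dot (g ∘ fsuc) xs ∎
    where open ≡-Reasoning

  length-elements : ∀ {l} (xs : Vec ℕ l) → length (elements xs) ≡ Vec.sum xs
  length-elements []       = refl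
  length-elements (x ∷ xs) = trans (length-++ (replicate x fzero)) (cong₂ _+_ (length-replicate x)
    (trans (length-map fsuc (elements xs)) (length-elements xs)))

  data Supported : ∀ {l} → Subset l → Vec ℕ l → Set where
    []   : Supported [] []
    zero : ∀ {l b} {A : Subset l} {xs} → Supported A xs → Supported (b ∷ A) (0 ∷ xs)
    any  : ∀ {l x} {A : Subset l} {xs} → Supported A xs → Supported (inside ∷ A) (x ∷ xs)

  elements⊆ : ∀ {l} {A : Subset l} {xs} → Supported A xs → All (_∈ˢ A) (elements xs)
  elements⊆ []                = []
  elements⊆ (zero s)          = All.map⁺ (All.map there (elements⊆ s))
  elements⊆ (any {x = x} s)   = All.++⁺ (All.replicate⁺ x here) (All.map⁺ (All.map there (elements⊆ s)))

  isB-lists : ∀ {n k} {A : Subset n} → IsB k A → ∀ us vs →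
    length us ≡ k → length vs ≡ k → All (_∈ˢ A) us → All (_∈ˢ A) vs →
    sum (map toℕ us) ≡ sum (map toℕ vs) → us ↭ vs
  isB-lists {n} {k} isB us vs lu lv us⊆A vs⊆A eq with vector us lu | vector vs lv
    where
    vector : ∀ ws → length ws ≡ k → ∃[ w ] Vec.toList {A = Fin n} {n = k} w ≡ ws
    vector ws refl = Vec.fromList ws , toList∘fromList ws
  ... | u , refl | v , refl = isB u v (VecAll.toList⁻ us⊆A) (VecAll.toList⁻ vs⊆A)
    (trans (sum-toList u) (trans eq (sym (sum-toList v))))
    where
    sum-toList : ∀ {m} (w : Vec (Fin n) m) → Vec.sum (Vec.map toℕ w) ≡ sum (map toℕ (Vec.toList w))
    sum-toList []      = refl
    sum-toList (i ∷ w) = cong (toℕ i +_) (sum-toList w)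

  -- Multisets of size less than k are padded with copies of a fixed element of A.
  isB-multiplicities : ∀ {n k a} {A : Subset n} → IsB k A → a ∈ˢ A → ∀ {xs ys} →
    Supported A xs → Supported A ys → Vec.sum xs ≤ k →
    Vec.sum xs ≡ Vec.sum ys → moment xs ≡ moment ys → xs ≡ ys
  isB-multiplicities {n} {k} {a} {A} isB a∈A {xs} {ys} sx sy ≤k sumEq momentEq = dot-injective λ g →
    +-cancelʳ-≡ (r * g a) (dot g xs) (dot g ys)
      (trans (sym (sum-padded g xs)) (trans (sum-↭ (↭-map⁺ g perm)) (sum-padded g ys)))
    where
    r = k ∸ Vec.sum xs
    padded : Vec ℕ n → List (Fin n)
    padded zs = elements zs ++ replicate r a
    sum-padded : ∀ g zs → sum (map g (padded zs)) ≡ dot g zs + r * g a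
    sum-padded g zs = trans (cong sum (map-++ g (elements zs) _)) (trans (sum-++ (map g (elements zs)) _)
      (cong₂ _+_ (sum-map-elements g zs) (trans (cong sum (map-replicate g r a)) (sum-replicate r (g a)))))
    length-padded : ∀ zs → Vec.sum xs ≡ Vec.sum zs → length (padded zs) ≡ k
    length-padded zs eq = trans (length-++ (elements zs)) (trans
      (cong₂ _+_ (trans (length-elements zs) (sym eq)) (length-replicate r))
      (m+[n∸m]≡n ≤k))
    padded⊆ : ∀ {zs} → Supported A zs → All (_∈ˢ A) (padded zs)
    padded⊆ s = All.++⁺ (elements⊆ s) (All.replicate⁺ r a∈A)
    perm : padded xs ↭ padded ys
    perm = isB-lists isB (padded xs) (padded ys) (length-padded xs refl) (length-padded ys sumEq)
      (padded⊆ sx) (padded⊆ sy)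
      (trans (sum-padded toℕ xs) (trans
        (cong (_+ r * toℕ a) (trans (dot-toℕ xs) (trans momentEq (sym (dot-toℕ ys)))))
        (sym (sum-padded toℕ ys))))

  data Step : Set where
    stay up down : Step

  #up #down : Step → ℕ
  #up   stay = 0
  #up   up   = 1
  #up   down = 0
  #down stay = 0
  #down up   = 0
  #down down = 1

  ups downs : ∀ {l} → Vec Step l → Vec ℕ l
  ups   = Vec.map #up
  downs = Vec.map #down

  -- Entrywise, the hypothesis equates the differences `#up` - `#down`, and these are the signs 0,
  -- 1, -1 that tell the steps apart.
  crossed-injective : ∀ {l} (c c′ : Vec Step l) →
    Vec.zipWith _+_ (ups c) (downs c′) ≡ Vec.zipWith _+_ (ups c′) (downs c) → c ≡ c′
  crossed-injective []      []        eq = refl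
  crossed-injective (s ∷ c) (s′ ∷ c′) eq =
    cong₂ _∷_ (step s s′ (cong Vec.head eq)) (crossed-injective c c′ (cong Vec.tail eq))
    where
    step : ∀ s s′ → #up s + #down s′ ≡ #up s′ + #down s → s ≡ s′
    step stay stay _ = refl
    step stay up   ()
    step stay down ()
    step up   stay ()
    step up   up   _ = refl
    step up   down ()
    step down stay ()
    step down up   ()
    step down down _ = refl

  sum-zipWith : ∀ {l} (xs ys : Vec ℕ l) → Vec.sum (Vec.zipWith _+_ xs ys) ≡ Vec.sum xs + Vec.sum ys
  sum-zipWith []       []       = refl
  sum-zipWith (x ∷ xs) (y ∷ ys) = trans (cong (x + y +_) (sum-zipWith xs ys))
    (interchange x y (Vec.sum xs) (Vec.sum ys))

  moment-zipWith : ∀ {l} (xs ys : Vec ℕ l) → moment (Vec.zipWith _+_ xs ys) ≡ moment xs + moment ys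
  moment-zipWith []       []       = refl
  moment-zipWith (x ∷ xs) (y ∷ ys) = trans (cong₂ _+_ (sum-zipWith xs ys) (moment-zipWith xs ys))
    (interchange (Vec.sum xs) (Vec.sum ys) (moment xs) (moment ys))

  -- The sum of the positions after each step, the start excluded. On a path to t the last summand
  -- is always t.
  height : ∀ {l} → ℕ → Vec Step l → ℕ
  height x []         = 0
  height x (stay ∷ c) = x + height x c
  height x (up ∷ c)   = suc x + height (suc x) c
  height x (down ∷ c) = pred x + height (pred x) c

  branch : ∀ {P A : Set} → Dec P → A → A → A
  branch (yes _) a b = a
  branch (no  _) a b = b

  -- Walks in [0, H] and the signed sums that they define

  module Walks (H : ℕ) where

    -- The number of walks of m steps ±1 from x to t within [0,H].
    walks : ℕ → ℕ → ℕ → ℕ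
    walks↑ walks↓ : ℕ → ℕ → ℕ → ℕ
    walks t zero    x = branch (x ≟ t) 1 0
    walks t (suc m) x = walks↑ t m x + walks↓ t m x
    walks↑ t m x = branch (x <? H) (walks t m (suc x)) 0
    walks↓ t m zero    = 0
    walks↓ t m (suc x) = walks t m x

    walks↑-< : ∀ t m {x} → x < H → walks↑ t m x ≡ walks t m (suc x)
    walks↑-< t m {x} x<H with x <? H
    ... | yes _   = refl
    ... | no  x≮H = contradiction x<H x≮H

    walks↑-≮ : ∀ t m {x} → H ≤ x → walks↑ t m x ≡ 0
    walks↑-≮ t m {x} H≤x with x <? H
    ... | yes x<H = contradiction H≤x (<⇒≱ x<H)
    ... | no  _   = refl

    walks-reflect : ∀ {t t′} m {x x′} → t + t′ ≡ H → x + x′ ≡ H → walks t m x ≡ walks t′ m x′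
    walks-reflect {t} {t′} zero {x} {x′} t+t′ x+x′ with x ≟ t | x′ ≟ t′
    ... | yes _    | yes _     = refl
    ... | no  _    | no  _     = refl
    ... | yes refl | no  x′≢t′ = contradiction (+-cancelˡ-≡ x x′ t′ (trans x+x′ (sym t+t′))) x′≢t′
    ... | no  x≢t  | yes refl  = contradiction (+-cancelʳ-≡ x′ x t (trans x+x′ (sym t+t′))) x≢t
    walks-reflect {t} {t′} (suc m) {x} {x′} t+t′ x+x′ = trans
      (cong₂ _+_ (swap t+t′ x x′ x+x′)
        (sym (swap (trans (+-comm t′ t) t+t′) x′ x (trans (+-comm x′ x) x+x′))))
      (+-comm (walks↓ t′ m x′) (walks↑ t′ m x′))
      where
      swap : ∀ {t t′} → t + t′ ≡ H → ∀ x x′ → x + x′ ≡ H → walks↑ t m x ≡ walks↓ t′ m x′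
      swap {t} t+t′ x zero     eq = walks↑-≮ t m (≤-reflexive (trans (sym eq) (+-identityʳ x)))
      swap {t} t+t′ x (suc x′) eq = trans
        (walks↑-< t m (subst (suc x ≤_) eq′ (m≤m+n (suc x) x′)))
        (walks-reflect m t+t′ eq′)
        where
        eq′ : suc x + x′ ≡ H
        eq′ = trans (sym (+-suc x x′)) eq

    private
      double : ∀ p w → p * w + p * w ≡ 2 * p * w
      double = solve-∀

    -- Forgets the first j steps, following at each of them the continuation with the larger count.
    -- The start moves to some y while the end t stays, so the remaining walks still have both ends
    -- in common.
    walks-drop : ∀ t j m {x} → x ≤ H → ∃[ y ] y ≤ H × walks t (j + m) x ≤ 2 ^ j * walks t m y
    walks-drop t zero    m {x} x≤H = x , x≤H , ≤-reflexive (sym (+-identityʳ _))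
    walks-drop t (suc j) m {x} x≤H with upper | lower x x≤H
      where
      Bound : ℕ → Set
      Bound w = ∃[ y ] y ≤ H × w ≤ 2 ^ j * walks t m y
      upper : Bound (walks↑ t (j + m) x)
      upper with x <? H
      ... | yes x<H = walks-drop t j m x<H
      ... | no  _   = x , x≤H , z≤n
      lower : ∀ x → x ≤ H → Bound (walks↓ t (j + m) x)
      lower zero    x≤H = 0 , x≤H , z≤n
      lower (suc x) x≤H = walks-drop t j m (<⇒≤ x≤H)
    ... | y , y≤H , ↑≤ | z , z≤H , ↓≤ with ≤-total (walks t m y) (walks t m z)
    ... | inj₁ y≤z = z , z≤H , ≤-trans (+-mono-≤ (≤-trans ↑≤ (*-monoʳ-≤ (2 ^ j) y≤z)) ↓≤)
      (≤-reflexive (double (2 ^ j) (walks t m z)))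
    ... | inj₂ z≤y = y , y≤H , ≤-trans (+-mono-≤ ↑≤ (≤-trans ↓≤ (*-monoʳ-≤ (2 ^ j) z≤y)))
      (≤-reflexive (double (2 ^ j) (walks t m y)))

    module _ (t : ℕ) where

      -- A walk that moves at m elements of A and stays put elsewhere: the coefficients of a signed sum.
      data Path : ∀ {l} → Subset l → ℕ → ℕ → Vec Step l → Set where
        done : Path [] 0 t []
        stay : ∀ {l b m x c} {A : Subset l} → Path A m x c → Path (b ∷ A) m x (stay ∷ c)
        up   : ∀ {l m x c} {A : Subset l} → x < H → Path A m (suc x) c →
               Path (inside ∷ A) (suc m) x (up ∷ c)
        down : ∀ {l m x c} {A : Subset l} → Path A m x c → Path (inside ∷ A) (suc m) (suc x) (down ∷ c)

      paths : ∀ {l} → Subset l → ℕ → ℕ → List (Vec Step l)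
      paths↑ paths↓ : ∀ {l} → Subset l → ℕ → ℕ → List (Vec Step l)
      paths [] zero    x = branch (x ≟ t) ([] ∷ []) []
      paths [] (suc m) x = []
      paths (outside ∷ A) m    x = map (stay ∷_) (paths A m x)
      paths (inside ∷ A) zero    x = map (stay ∷_) (paths A zero x)
      paths (inside ∷ A) (suc m) x = map (stay ∷_) (paths A (suc m) x) ++
        map (up ∷_) (paths↑ A m x) ++ map (down ∷_) (paths↓ A m x)
      paths↑ A m x = branch (x <? H) (paths A m (suc x)) []
      paths↓ A m zero    = []
      paths↓ A m (suc x) = paths A m x

      -- The m moving elements of A and the walk are chosen independently; the recursion along A is
      -- Pascal's rule.
      length-paths : ∀ {l} (A : Subset l) m x → length (paths A m x) ≡ (∣ A ∣ C m) * walks t m x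
      length-paths [] zero x with x ≟ t
      ... | yes _ = refl
      ... | no  _ = refl
      length-paths [] (suc m) x = refl
      length-paths (outside ∷ A) m x = trans (length-map (stay ∷_) (paths A m x)) (length-paths A m x)
      length-paths (inside ∷ A) zero x = trans (length-map (stay ∷_) (paths A zero x)) (length-paths A zero x)
      length-paths (inside ∷ A) (suc m) x = begin
        length (map (stay ∷_) (paths A (suc m) x) ++ map (up ∷_) (paths↑ A m x) ++ map (down ∷_) (paths↓ A m x))
          ≡⟨ trans (length-++ (map (stay ∷_) (paths A (suc m) x)))
               (cong₂ _+_ (length-map _ (paths A (suc m) x))
                 (trans (length-++ (map (up ∷_) (paths↑ A m x)))
                   (cong₂ _+_ (length-map _ (paths↑ A m x)) (length-map _ (paths↓ A m x))))) ⟩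
        length (paths A (suc m) x) + (length (paths↑ A m x) + length (paths↓ A m x))
          ≡⟨ cong₂ _+_ (length-paths A (suc m) x) (cong₂ _+_ length↑ (length↓ x)) ⟩
        (N C suc m) * walks t (suc m) x + ((N C m) * walks↑ t m x + (N C m) * walks↓ t m x)
          ≡⟨ collect (N C suc m) (N C m) (walks↑ t m x) (walks↓ t m x) ⟩
        ((N C m) + (N C suc m)) * walks t (suc m) x
          ≡⟨ cong (_* walks t (suc m) x) (nCk+nC[k+1]≡[n+1]C[k+1] N m) ⟩
        (suc N C suc m) * walks t (suc m) x ∎
        where
        open ≡-Reasoning
        N = ∣ A ∣
        length↑ : length (paths↑ A m x) ≡ (N C m) * walks↑ t m x
        length↑ with x <? H
        ... | yes _ = length-paths A m (suc x)
        ... | no  _ = sym (*-zeroʳ (N C m))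
        length↓ : ∀ x → length (paths↓ A m x) ≡ (N C m) * walks↓ t m x
        length↓ zero    = sym (*-zeroʳ (N C m))
        length↓ (suc x) = length-paths A m x
        collect : ∀ a b u d → a * (u + d) + (b * u + b * d) ≡ (b + a) * (u + d)
        collect = solve-∀

      paths-sound : ∀ {l} (A : Subset l) m x → All (Path A m x) (paths A m x)
      paths-sound [] zero x with x ≟ t
      ... | yes refl = done ∷ []
      ... | no  _    = []
      paths-sound [] (suc m) x = []
      paths-sound (outside ∷ A) m x = All.map⁺ (All.map stay (paths-sound A m x))
      paths-sound (inside ∷ A) zero x = All.map⁺ (All.map stay (paths-sound A zero x))
      paths-sound (inside ∷ A) (suc m) x = All.++⁺ (All.map⁺ (All.map stay (paths-sound A (suc m) x)))
        (All.++⁺ (All.map⁺ sound↑) (All.map⁺ (sound↓ x)))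
        where
        sound↑ : All (λ c → Path (inside ∷ A) (suc m) x (up ∷ c)) (paths↑ A m x)
        sound↑ with x <? H
        ... | yes x<H = All.map (up x<H) (paths-sound A m (suc x))
        ... | no  _   = []
        sound↓ : ∀ x → All (λ c → Path (inside ∷ A) (suc m) x (down ∷ c)) (paths↓ A m x)
        sound↓ zero    = []
        sound↓ (suc x) = All.map down (paths-sound A m x)

      paths-unique : ∀ {l} (A : Subset l) m x → Unique (paths A m x)
      paths-unique [] zero x with x ≟ t
      ... | yes _ = [] ∷ []
      ... | no  _ = []
      paths-unique [] (suc m) x = []
      paths-unique (outside ∷ A) m x = Unique.map⁺ (cong Vec.tail) (paths-unique A m x)
      paths-unique (inside ∷ A) zero x = Unique.map⁺ (cong Vec.tail) (paths-unique A zero x)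
      paths-unique {suc l} (inside ∷ A) (suc m) x = Unique.++⁺
        (Unique.map⁺ (cong Vec.tail) (paths-unique A (suc m) x))
        (Unique.++⁺ (Unique.map⁺ (cong Vec.tail) unique↑) (Unique.map⁺ (cong Vec.tail) (unique↓ x))
          (disjoint (paths↑ A m x) (paths↓ A m x) λ ()))
        λ (p , q) → case-++ p (∈-++⁻ (map (up ∷_) (paths↑ A m x)) q)
        where
        disjoint : ∀ {s s′} (cs cs′ : List (Vec Step l)) → s ≢ s′ → Disjoint (map (s ∷_) cs) (map (s′ ∷_) cs′)
        disjoint cs cs′ s≢s′ (p , q) with ∈-map⁻ _ p | ∈-map⁻ _ q
        ... | _ , _ , refl | _ , _ , eq = s≢s′ (cong Vec.head eq)
        case-++ : ∀ {c} → c ∈ map (stay ∷_) (paths A (suc m) x) → _ → _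
        case-++ p (inj₁ q) = disjoint (paths A (suc m) x) (paths↑ A m x) (λ ()) (p , q)
        case-++ p (inj₂ q) = disjoint (paths A (suc m) x) (paths↓ A m x) (λ ()) (p , q)
        unique↑ : Unique (paths↑ A m x)
        unique↑ with x <? H
        ... | yes _ = paths-unique A m (suc x)
        ... | no  _ = []
        unique↓ : ∀ x → Unique (paths↓ A m x)
        unique↓ zero    = []
        unique↓ (suc x) = paths-unique A m x

      path-displacement : ∀ {l m x c} {A : Subset l} → Path A m x c →
        x + Vec.sum (ups c) ≡ t + Vec.sum (downs c)
      path-displacement done     = refl
      path-displacement (stay p) = path-displacement p
      path-displacement {x = x} {up ∷ c} (up _ p)   = trans (+-suc x (Vec.sum (ups c))) (path-displacement p)
      path-displacement {c = down ∷ c}   (down p)   =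
        trans (cong suc (path-displacement p)) (sym (+-suc t (Vec.sum (downs c))))

      path-moves : ∀ {l m x c} {A : Subset l} → Path A m x c → Vec.sum (ups c) + Vec.sum (downs c) ≡ m
      path-moves done     = refl
      path-moves (stay p) = path-moves p
      path-moves (up _ p) = cong suc (path-moves p)
      path-moves {c = down ∷ c} (down p) =
        trans (+-suc (Vec.sum (ups c)) (Vec.sum (downs c))) (cong suc (path-moves p))

      -- Treats the three kinds of step alike: the bounds on heights depend on a step only through
      -- the position y that it leads to.
      path-tail : ∀ {l b m x s c} {A : Subset l} → Path (b ∷ A) m x (s ∷ c) →
        ∃[ y ] ∃[ m′ ] (Path A m′ y c × height x (s ∷ c) ≡ y + height y c × x ≤ suc y × (x ≤ H → y ≤ H))
      path-tail {m = m} {x} (stay p) = x , m , p , refl , n≤1+n x , λ x≤H → x≤H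
      path-tail {m = suc m} {x} (up x<H p) = suc x , m , p , refl , m≤n+m x 2 , λ _ → x<H
      path-tail {m = suc m} {suc x} (down p) = x , m , p , refl , ≤-refl , <⇒≤

      -- Abel summation: up to the constant l * t, the height is the signed sum Σ ±i.
      path-height : ∀ {l m x c} {A : Subset l} → Path A m x c →
        height x c + moment (ups c) ≡ l * t + moment (downs c)
      path-height done = refl
      path-height {suc l} {c = s ∷ c} {b ∷ A} p with path-tail p
      ... | y , m′ , q , eq , _ = begin
        height _ (s ∷ c) + (u + moment (ups c))     ≡⟨ cong (_+ (u + moment (ups c))) eq ⟩
        y + height y c + (u + moment (ups c))       ≡⟨ interchange y (height y c) u (moment (ups c)) ⟩
        y + u + (height y c + moment (ups c))       ≡⟨ cong₂ _+_ (path-displacement q) (path-height q) ⟩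
        t + d + (l * t + moment (downs c))          ≡⟨ interchange t d (l * t) (moment (downs c)) ⟩
        t + l * t + (d + moment (downs c))          ∎
        where
        open ≡-Reasoning
        u = Vec.sum (ups c)
        d = Vec.sum (downs c)

      path-end : ∀ {m x} → Path [] m x [] → x ≡ t
      path-end done = refl

      height-end : ∀ {b m x} {c : Vec Step 1} → Path (b ∷ []) m x c → height x c ≡ t × x ≤ suc t
      height-end {c = s ∷ []} p with path-tail p
      ... | y , m′ , q , eq , x≤1+y , _ with path-end q
      ... | refl = trans eq (+-identityʳ y) , x≤1+y

      -- Of the l + 1 summed positions the last one is t and the others lie in [0, H]. Together with
      -- `height≤` this leaves l * H + 1 values.
      t≤height : ∀ {l m x c} {A : Subset (suc l)} → Path A m x c → t ≤ height x c
      t≤height {zero} {A = b ∷ []} p = ≤-reflexive (sym (proj₁ (height-end p)))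
      t≤height {suc l} {c = s ∷ c} {b ∷ A} p with path-tail p
      ... | y , m′ , q , eq , _ = ≤-trans (t≤height q) (≤-trans (m≤n+m _ y) (≤-reflexive (sym eq)))

      height≤ : ∀ {l m x c} {A : Subset (suc l)} → x ≤ H → Path A m x c → height x c ≤ t + l * H
      height≤ {zero} {A = b ∷ []} x≤H p = ≤-reflexive (trans (proj₁ (height-end p)) (sym (+-identityʳ t)))
      height≤ {suc l} {x = x} {c = s ∷ c} {b ∷ A} x≤H p with path-tail p
      ... | y , m′ , q , eq , _ , bound = begin
        height x (s ∷ c) ≡⟨ eq ⟩
        y + height y c   ≤⟨ +-mono-≤ (bound x≤H) (height≤ (bound x≤H) q) ⟩
        H + (t + l * H)  ≡⟨ +-swap H t (l * H) ⟩
        t + suc l * H    ∎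
        where open ≤-Reasoning

      -- The last position before t is at most t + 1.
      height< : ∀ {l m x c} {A : Subset (2 + l)} → x ≤ H → suc t < H → Path A m x c →
        height x c < t + suc l * H
      height< {l} {x = x} {c = s ∷ c} {b ∷ A} x≤H t+1<H p with path-tail p
      height< {zero} {x = x} {s ∷ c} {b ∷ b′ ∷ []} x≤H t+1<H p | y , m′ , q , eq , _ with height-end q
      ... | eq′ , y≤1+t = begin-strict
        height x (s ∷ c) ≡⟨ eq ⟩
        y + height y c   ≤⟨ +-mono-≤ y≤1+t (≤-reflexive eq′) ⟩
        suc t + t        <⟨ +-monoˡ-< t t+1<H ⟩
        H + t            ≡⟨ +-comm H t ⟩
        t + H            ≡⟨ cong (t +_) (+-identityʳ H) ⟨
        t + 1 * H        ∎
        where open ≤-Reasoning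
      height< {suc l} {x = x} {s ∷ c} {b ∷ A} x≤H t+1<H p | y , m′ , q , eq , _ , bound = begin-strict
        height x (s ∷ c)    ≡⟨ eq ⟩
        y + height y c      <⟨ +-mono-≤-< (bound x≤H) (height< (bound x≤H) t+1<H q) ⟩
        H + (t + suc l * H) ≡⟨ +-swap H t (suc l * H) ⟩
        t + (2 + l) * H     ∎
        where open ≤-Reasoning

      crossed-supported : ∀ {l m m′ x x′ c c′} {A : Subset l} → Path A m x c → Path A m′ x′ c′ →
        Supported A (Vec.zipWith _+_ (ups c) (downs c′))
      crossed-supported done       done       = []
      crossed-supported (stay p)   (stay q)   = zero (crossed-supported p q)
      crossed-supported (stay p)   (up _ q)   = zero (crossed-supported p q)
      crossed-supported (stay p)   (down q)   = any (crossed-supported p q)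
      crossed-supported (up _ p)   (stay q)   = any (crossed-supported p q)
      crossed-supported (up _ p)   (up _ q)   = any (crossed-supported p q)
      crossed-supported (up _ p)   (down q)   = any (crossed-supported p q)
      crossed-supported (down p)   (stay q)   = zero (crossed-supported p q)
      crossed-supported (down p)   (up _ q)   = zero (crossed-supported p q)
      crossed-supported (down p)   (down q)   = any (crossed-supported p q)

      -- An equality P - M = P′ - M′ of signed sums becomes an equality P + M′ = P′ + M of sums of
      -- equally many terms.
      height-injective : ∀ {l k m x a} {A : Subset l} → IsB k A → a ∈ˢ A → m ≤ k →
        ∀ {c c′} → Path A m x c → Path A m x c′ → height x c ≡ height x c′ → c ≡ c′
      height-injective {l} {k} {m} {x} isB a∈A m≤k {c} {c′} p p′ eq = crossed-injective c c′
        (isB-multiplicities isB a∈A (crossed-supported p p′) (crossed-supported p′ p)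
          (≤-trans (≤-reflexive (sum-zipWith (ups c) (downs c′))) (≤-trans size m≤k))
          (trans (sum-zipWith (ups c) (downs c′)) (trans sums (sym (sum-zipWith (ups c′) (downs c)))))
          (trans (moment-zipWith (ups c) (downs c′)) (trans moments (sym (moment-zipWith (ups c′) (downs c))))))
        where
        open ≡-Reasoning
        u  = Vec.sum (ups c)
        d  = Vec.sum (downs c)
        u′ = Vec.sum (ups c′)
        d′ = Vec.sum (downs c′)
        cross : ∀ {a b u d u′ d′} → a + u ≡ b + d → a + u′ ≡ b + d′ → u + d′ ≡ u′ + d
        cross {a} {b} {u} {d} {u′} {d′} e e′ = +-cancelˡ-≡ (a + b) (u + d′) (u′ + d) (begin
          a + b + (u + d′)   ≡⟨ interchange a b u d′ ⟩
          a + u + (b + d′)   ≡⟨ cong₂ _+_ e (sym e′) ⟩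
          b + d + (a + u′)   ≡⟨ interchange b d a u′ ⟩
          b + a + (d + u′)   ≡⟨ cong₂ _+_ (+-comm b a) (+-comm d u′) ⟩
          a + b + (u′ + d)   ∎)
        sums : u + d′ ≡ u′ + d
        sums = cross {x} {t} {u} {d} {u′} {d′} (path-displacement p) (path-displacement p′)
        -- Both sides of the crossed relation have equally many terms, and together they use up the
        -- m moves of each path.
        size : u + d′ ≤ m
        size = *-cancelˡ-≤ 2 (≤-reflexive (begin
          2 * (u + d′)        ≡⟨ cong (u + d′ +_) (+-identityʳ (u + d′)) ⟩
          u + d′ + (u + d′)   ≡⟨ cong (u + d′ +_) sums ⟩
          u + d′ + (u′ + d)   ≡⟨ cong (u + d′ +_) (+-comm u′ d) ⟩
          u + d′ + (d + u′)   ≡⟨ interchange u d′ d u′ ⟩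
          u + d + (d′ + u′)   ≡⟨ cong (u + d +_) (+-comm d′ u′) ⟩
          u + d + (u′ + d′)   ≡⟨ cong₂ _+_ (path-moves p) (path-moves p′) ⟩
          m + m               ≡⟨ cong (m +_) (+-identityʳ m) ⟨
          2 * m               ∎))
        moments : moment (ups c) + moment (downs c′) ≡ moment (ups c′) + moment (downs c)
        moments = cross {height x c} {l * t} {moment (ups c)} {moment (downs c)} {moment (ups c′)} {moment (downs c′)}
          (path-height p)
          (trans (cong (_+ moment (ups c′)) eq) (path-height p′))

      module _ {n k m x : ℕ} {a : Fin (suc n)} {A : Subset (suc n)} (isB : IsB k A) (a∈A : a ∈ˢ A) (m≤k : m ≤ k) (x≤H : x ≤ H) where

        private
          heights : List ℕ
          heights = map (height x) (paths A m x)

          -- Pigeonhole: distinct paths have distinct heights in [t, t + w).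
          count-heights : ∀ w → All (λ c → height x c < t + w) (paths A m x) → (∣ A ∣ C m) * walks t m x ≤ w
          count-heights w bound = subst (_≤ w) (trans (length-map (height x) (paths A m x)) (length-paths A m x))
            (length-interval t w
              (map-unique (height-injective isB a∈A m≤k) (paths-sound A m x) (paths-unique A m x))
              (All.map⁺ (All.zipWith (λ (p , h<) → t≤height p , h<) (paths-sound A m x , bound))))

        walks-bound : (∣ A ∣ C m) * walks t m x ≤ suc (n * H)
        walks-bound = count-heights (suc (n * H)) (All.map
          (λ {c} p → subst (suc (height x c) ≤_) (sym (+-suc t (n * H))) (s≤s (height≤ x≤H p)))
          (paths-sound A m x))

        walks-bound-strict : .{{_ : NonZero n}} → suc t < H → (∣ A ∣ C m) * walks t m x ≤ n * H
        walks-bound-strict t+1<H = count-heights (n * H) (All.map (strict n) (paths-sound A m x))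
          where
          strict : ∀ n .{{_ : NonZero n}} {A : Subset (suc n)} {c} → Path A m x c → height x c < t + n * H
          strict (suc n) = height< x≤H t+1<H

-- Deviation sets as run lengths of walks

module DeviationSets where

  open import Defs using (ζ; IsDeviation; isDeviation?; tuples; altSum; sumOdd; sumEven)
  open import Data.Nat
  open import Data.Nat.Properties
  open import Algebra.Properties.CommutativeSemigroup +-commutativeSemigroup using (x∙yz≈y∙xz)
  open SignedSums

  concatMap-unique : ∀ {A B : Set} (f : A → List B) {as} → (∀ a → Unique (f a)) →
    (∀ {a a′ b} → b ∈ f a → b ∈ f a′ → a ≡ a′) → Unique as → Unique (concatMap f as)
  concatMap-unique f unique disjoint u = Unique.concat⁺
    (All.map⁺ (All.universal unique _))
    (AllPairs.map⁺ (AllPairs.map (λ a≢a′ {_} pq → a≢a′ (disjoint (proj₁ pq) (proj₂ pq))) u))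

  tuples-length : ∀ {A : Set} ℓ {xs : List A} {ys} → ys ∈ tuples ℓ xs → length ys ≡ ℓ
  tuples-length zero    (here refl) = refl
  tuples-length (suc ℓ) {xs} ys∈ with find (∈-concatMap⁻ (λ x → map (x ∷_) (tuples ℓ xs)) {xs = xs} ys∈)
  ... | x , _ , ys∈′ with ∈-map⁻ (x ∷_) ys∈′
  ... | zs , zs∈ , refl = cong suc (tuples-length ℓ zs∈)

  tuples-unique : ∀ {A : Set} ℓ {xs : List A} → Unique xs → Unique (tuples ℓ xs)
  tuples-unique zero    u = [] ∷ []
  tuples-unique (suc ℓ) {xs} u = concatMap-unique (λ x → map (x ∷_) (tuples ℓ xs))
    (λ x → Unique.map⁺ {f = x ∷_} (λ { refl → refl }) (tuples-unique ℓ u)) heads u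
    where
    heads : ∀ {a a′ b} → b ∈ map (a ∷_) (tuples ℓ xs) → b ∈ map (a′ ∷_) (tuples ℓ xs) → a ≡ a′
    heads p q with ∈-map⁻ _ p | ∈-map⁻ _ q
    ... | _ , _ , refl | _ , _ , refl = refl

  candidates-unique : ∀ m → Unique (concatMap (λ ℓ → tuples ℓ (upTo (suc m))) (upTo (suc m)))
  candidates-unique m = concatMap-unique (λ ℓ → tuples ℓ (upTo (suc m)))
    (λ ℓ → tuples-unique ℓ (Unique.upTo⁺ (suc m)))
    (λ {ℓ} {ℓ′} p q → trans (sym (tuples-length ℓ p)) (tuples-length ℓ′ q))
    (Unique.upTo⁺ (suc m))

  -- Only an upper bound for `ζ` is wanted, so it is enough to list all deviation sets in `ys`,
  -- possibly among others. Since `ζ` counts list entries, the candidates have to be distinct.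
  ζ≤ : ∀ m δ ys → (∀ {α} → IsDeviation m δ α → α ∈ ys) → ζ m δ ≤ length ys
  ζ≤ m δ ys complete = length-⊆ (Unique.filter⁺ (isDeviation? m δ) (candidates-unique m))
    λ α∈ → complete (proj₂ (∈-filter⁻ (isDeviation? m δ) {xs = concatMap (λ ℓ → tuples ℓ (upTo (suc m))) (upTo (suc m))} α∈))

  -- Prolongs the first run by one step. The empty list is a default: the encodings in `runs↑` and
  -- `runs↓` have at least one run.
  incHead : List ℕ → List ℕ
  incHead []       = []
  incHead (a ∷ as) = suc a ∷ as

  module Runs (H t : ℕ) where
    open Walks H

    -- The run-length encodings of the walks that are now at y after one step up (down)
    -- and reach t in m further steps.
    runs↑ runs↓ : ℕ → ℕ → List (List ℕ)
    above below : (ℕ → List (List ℕ)) → ℕ → List (List ℕ)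
    above f y = branch (y <? H) (f (suc y)) []
    below f zero    = []
    below f (suc y) = f y
    runs↑ zero    y = branch (y ≟ t) ((1 ∷ []) ∷ []) []
    runs↑ (suc m) y = map incHead (above (runs↑ m) y) ++ map (1 ∷_) (below (runs↓ m) y)
    runs↓ zero    y = branch (y ≟ t) ((1 ∷ []) ∷ []) []
    runs↓ (suc m) y = map incHead (below (runs↓ m) y) ++ map (1 ∷_) (above (runs↑ m) y)

    length-maps : ∀ {A B : Set} (f g : A → B) xs ys → length (map f xs ++ map g ys) ≡ length xs + length ys
    length-maps f g xs ys = trans (length-++ (map f xs)) (cong₂ _+_ (length-map f xs) (length-map g ys))

    length-above : ∀ m {f} → (∀ y → length (f y) ≡ walks t m y) → ∀ y → length (above f y) ≡ walks↑ t m y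
    length-above m eq y with y <? H
    ... | yes _ = eq (suc y)
    ... | no  _ = refl

    length-below : ∀ m {f} → (∀ y → length (f y) ≡ walks t m y) → ∀ y → length (below f y) ≡ walks↓ t m y
    length-below m eq zero    = refl
    length-below m eq (suc y) = eq y

    -- The next step either prolongs the first run or opens a new one, so the encodings obey the
    -- recursion of `walks`.
    length-runs : ∀ m y → length (runs↑ m y) ≡ walks t m y × length (runs↓ m y) ≡ walks t m y
    length-runs zero y with y ≟ t
    ... | yes _ = refl , refl
    ... | no  _ = refl , refl
    length-runs (suc m) y =
      trans (length-maps incHead (1 ∷_) (above (runs↑ m) y) _) (cong₂ _+_ ↑ ↓) ,
      trans (length-maps incHead (1 ∷_) (below (runs↓ m) y) _) (trans (cong₂ _+_ ↓ ↑) (+-comm (walks↓ t m y) _))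
      where
      ↑ = length-above m {runs↑ m} (proj₁ ∘ length-runs m) y
      ↓ = length-below m {runs↓ m} (proj₂ ∘ length-runs m) y

    -- The walks to t whose runs alternate in direction and have the given lengths.
    data Zig↑ : ℕ → List ℕ → Set
    data Zig↓ : ℕ → List ℕ → Set
    data Zig↑ where
      [] : Zig↑ t []
      up : ∀ {x a as} → x + suc a ≤ H → Zig↓ (x + suc a) as → Zig↑ x (suc a ∷ as)
    data Zig↓ where
      []   : Zig↓ t []
      down : ∀ {x a as} → Zig↑ x as → Zig↓ (suc a + x) (suc a ∷ as)

    above-< : ∀ {f y α} → y < H → α ∈ f (suc y) → α ∈ above f y
    above-< {y = y} y<H α∈ with y <? H
    ... | yes _   = α∈
    ... | no  y≮H = contradiction y<H y≮H

    stop : List.[ 1 ] ∈ branch (t ≟ t) ((1 ∷ []) ∷ []) []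
    stop with t ≟ t
    ... | yes _   = here refl
    ... | no  t≢t = contradiction refl t≢t

    -- The step that led to y already belongs to the run of length `suc a`, so a steps of it are
    -- left. The recursion on a walks through the run; `turn↓` and `turn↑` pass on to the next one.
    runs↑-complete : ∀ {as y} a → y + a ≤ H → Zig↓ (y + a) as → suc a ∷ as ∈ runs↑ (a + sum as) y
    runs↓-complete : ∀ {as x} a → a + x ≤ H → Zig↑ x as → suc a ∷ as ∈ runs↓ (a + sum as) (a + x)
    turn↓ : ∀ {as y} → y ≤ H → Zig↓ y as → 1 ∷ as ∈ runs↑ (sum as) y
    turn↑ : ∀ {as x} → Zig↑ x as → 1 ∷ as ∈ runs↓ (sum as) x
    runs↑-complete {as} {y} (suc a) y+a≤H z = ∈-++⁺ˡ (∈-map⁺ incHead (above-< {runs↑ (a + sum as)}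
      (≤-trans (s≤s (m≤m+n y a)) y+a≤H′)
      (runs↑-complete a y+a≤H′ (subst (λ w → Zig↓ w as) (+-suc y a) z))))
      where
      y+a≤H′ = subst (_≤ H) (+-suc y a) y+a≤H
    runs↑-complete {as} {y} zero y≤H z = turn↓ (subst (_≤ H) (+-identityʳ y) y≤H)
      (subst (λ w → Zig↓ w as) (+-identityʳ y) z)
    runs↓-complete (suc a) a+x≤H z = ∈-++⁺ˡ (∈-map⁺ incHead (runs↓-complete a (<⇒≤ a+x≤H) z))
    runs↓-complete zero    x≤H   z = turn↑ z
    turn↓ y≤H [] = stop
    turn↓ {suc b ∷ bs} {suc y} y≤H (down z) =
      ∈-++⁺ʳ (map incHead (above (runs↑ (b + sum bs)) (suc y))) (∈-map⁺ (1 ∷_) (runs↓-complete b (<⇒≤ y≤H) z))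
    turn↑ [] = stop
    turn↑ {suc b ∷ bs} {x} (up x+b<H z) =
      ∈-++⁺ʳ (map incHead (below (runs↓ (b + sum bs)) x)) (∈-map⁺ (1 ∷_) (above-< {runs↑ (b + sum bs)}
        (≤-trans (s≤s (m≤m+n x b)) x+b<H′)
        (runs↑-complete b x+b<H′ (subst (λ w → Zig↓ w bs) (+-suc x b) z))))
      where
      x+b<H′ = subst (_≤ H) (+-suc x b) x+b<H

    InRange : ℤ → Set
    InRange i = ℤ.+ 0 ℤ.≤ i × i ℤ.≤ ℤ.+ H

    prefixSum : (α : List ℕ) → Fin (length α) → ℤ
    prefixSum α j = altSum (take (suc (toℕ j)) α)

    -- Condition (iii) bounds the walk at the ends of runs only. Runs being monotone, the upper
    -- bound at the end of an upward run and the lower bound at the end of a downward run keep the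
    -- whole walk in [0, H]. The equation says that the walk ends at t.
    zig↑ : ∀ {x} α → All (0 <_) α → t + sumEven α ≡ x + sumOdd α →
      (∀ j → InRange (ℤ.+ x ℤ.+ prefixSum α j)) → Zig↑ x α
    zig↓ : ∀ {x} α → All (0 <_) α → t + sumOdd α ≡ x + sumEven α →
      (∀ j → InRange (ℤ.+ x ℤ.- prefixSum α j)) → Zig↓ x α
    zig↑ [] [] eq _ = subst (λ w → Zig↑ w []) (+-cancelʳ-≡ 0 t _ eq) []
    zig↑ {x} (suc a ∷ as) (_ ∷ pos) eq range = up
      (subst (_≤ H) (cong (x +_) (+-identityʳ (suc a))) (ℤ.drop‿+≤+ (proj₂ (range fzero))))
      (zig↓ as pos (trans eq (sym (+-assoc x (suc a) (sumEven as))))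
        λ j → subst InRange (sym (ℤ.+-assoc (ℤ.+ x) (ℤ.+ suc a) (ℤ.- prefixSum as j))) (range (fsuc j)))
    zig↓ [] [] eq _ = subst (λ w → Zig↓ w []) (+-cancelʳ-≡ 0 t _ eq) []
    zig↓ {x} (suc a ∷ as) (_ ∷ pos) eq range = subst (λ w → Zig↓ w (suc a ∷ as)) (m+[n∸m]≡n a≤x)
      (down (zig↑ as pos
        (+-cancelˡ-≡ (suc a) _ _ (begin
          suc a + (t + sumEven as)  ≡⟨ x∙yz≈y∙xz (suc a) t (sumEven as) ⟩
          t + (suc a + sumEven as)  ≡⟨ eq ⟩
          x + sumOdd as             ≡⟨ cong (_+ sumOdd as) (m+[n∸m]≡n a≤x) ⟨
          suc a + y + sumOdd as     ≡⟨ +-assoc (suc a) y (sumOdd as) ⟩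
          suc a + (y + sumOdd as)   ∎))
        λ j → subst InRange (shift (prefixSum as j)) (range (fsuc j))))
      where
      open ≡-Reasoning
      a≤x : suc a ≤ x
      a≤x = ℤ.drop‿+≤+ (ℤ.0≤i-j⇒j≤i (subst (λ w → ℤ.+ 0 ℤ.≤ ℤ.+ x ℤ.- w)
        (ℤ.+-identityʳ (ℤ.+ suc a)) (proj₁ (range fzero))))
      y = x ∸ suc a
      cancel : ∀ a y s → a ℤ.+ y ℤ.- (a ℤ.- s) ≡ y ℤ.+ s
      cancel = ℤ.solve-∀
      shift : ∀ s → ℤ.+ x ℤ.- (ℤ.+ suc a ℤ.- s) ≡ ℤ.+ y ℤ.+ s
      shift s = trans (cong (λ w → w ℤ.- (ℤ.+ suc a ℤ.- s)) (cong ℤ.+_ (sym (m+[n∸m]≡n a≤x)))) (cancel (ℤ.+ suc a) (ℤ.+ y) s)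

  module _ (δ : ℕ) where
    open Walks (2 * δ)
    open Runs (2 * δ)

    centre-range : ∀ {i} → ℤ.∣ i ∣ ≤ δ → InRange δ (ℤ.+ δ ℤ.+ i)
    centre-range {ℤ.+ i} i≤δ = ℤ.+≤+ z≤n , ℤ.+≤+ (+-monoʳ-≤ δ (≤-trans i≤δ (m≤m+n δ 0)))
    centre-range { ℤ.-[1+ i ]} i<δ rewrite ℤ.⊖-≥ i<δ = ℤ.+≤+ z≤n , ℤ.+≤+ (≤-trans (m∸n≤m δ (suc i)) (m≤m+n δ (δ + 0)))

    -- The first run goes up, so the first of the `suc k` steps leads from δ to `suc δ` and k steps
    -- remain.
    deviation∈runs : ∀ {k t α} → IsDeviation (suc k) δ α → t + sumEven α ≡ δ + sumOdd α → α ∈ runs↑ t k (suc δ)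
    deviation∈runs {k} {t} {α} (pos , total , _ , bound) eq = start α (zig↑ t α pos eq (λ j → centre-range {altSum (take (suc (toℕ j)) α)} (bound j))) total
      where
      start : ∀ α → Zig↑ t δ α → sum α ≡ suc k → α ∈ runs↑ t k (suc δ)
      start (suc a ∷ as) (up δ+a<H z) refl = runs↑-complete t a (subst (_≤ 2 * δ) (+-suc δ a) δ+a<H)
        (subst (λ w → Zig↓ t w as) (+-suc δ a) z)

  sumOdd+sumEven : ∀ α → sumOdd α + sumEven α ≡ sum α
  sumOdd+sumEven []       = refl
  sumOdd+sumEven (a ∷ as) = trans (+-assoc a (sumEven as) (sumOdd as))
    (cong (a +_) (trans (+-comm (sumEven as) (sumOdd as)) (sumOdd+sumEven as)))

  near : ∀ m n → ∣ m - n ∣ ≤ 1 → m ≡ n ⊎ m ≡ suc n ⊎ n ≡ suc m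
  near zero    zero          _ = inj₁ refl
  near zero    (suc zero)    _ = inj₂ (inj₂ refl)
  near (suc zero) zero       _ = inj₂ (inj₁ refl)
  near zero    (suc (suc n)) (s≤s ())
  near (suc (suc m)) zero    (s≤s ())
  near (suc m) (suc n)       p with near m n p
  ... | inj₁ eq        = inj₁ (cong suc eq)
  ... | inj₂ (inj₁ eq) = inj₂ (inj₁ (cong suc eq))
  ... | inj₂ (inj₂ eq) = inj₂ (inj₂ (cong suc eq))

  [b+2n]%2≡b%2 : ∀ b n → (b + (n + n)) % 2 ≡ b % 2
  [b+2n]%2≡b%2 b n = trans (cong (λ w → (b + w) % 2) (double n)) ([m+kn]%n≡m%n b n 2)
    where
    double : ∀ n → n + n ≡ n * 2
    double = solve-∀

  -- The difference of the two sums has the parity of their total k, so condition (ii) leaves 0 for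
  -- even k and ±1 for odd k.
  deviation-end : ∀ {k δ α} → IsDeviation k δ α →
    (k % 2 ≡ 0 → sumOdd α ≡ sumEven α) ×
    (k % 2 ≡ 1 → sumOdd α ≡ suc (sumEven α) ⊎ sumEven α ≡ suc (sumOdd α))
  deviation-end {k} {δ} {α} (_ , total , balanced , _) with near (sumOdd α) (sumEven α) balanced
  ... | inj₁ eq = (λ _ → eq) , λ odd → contradiction (trans (sym (k%2 eq)) odd) λ ()
    where
    k%2 : sumOdd α ≡ sumEven α → k % 2 ≡ 0
    k%2 eq = trans (cong (_% 2) (trans (sym total) (trans (sym (sumOdd+sumEven α)) (cong (_+ sumEven α) eq))))
      ([b+2n]%2≡b%2 0 (sumEven α))
  ... | inj₂ (inj₁ eq) = (λ even → contradiction (trans (sym (k%2 eq)) even) λ ()) , λ _ → inj₁ eq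
    where
    k%2 : sumOdd α ≡ suc (sumEven α) → k % 2 ≡ 1
    k%2 eq = trans (cong (_% 2) (trans (sym total) (trans (sym (sumOdd+sumEven α)) (cong (_+ sumEven α) eq))))
      ([b+2n]%2≡b%2 1 (sumEven α))
  ... | inj₂ (inj₂ eq) = (λ even → contradiction (trans (sym (k%2 eq)) even) λ ()) , λ _ → inj₂ eq
    where
    k%2 : sumEven α ≡ suc (sumOdd α) → k % 2 ≡ 1
    k%2 eq = trans (cong (_% 2) (trans (sym total) (trans (sym (sumOdd+sumEven α))
      (trans (cong (sumOdd α +_) eq) (+-suc (sumOdd α) (sumOdd α)))))) ([b+2n]%2≡b%2 1 (sumOdd α))

  module _ (d k : ℕ) where
    private
      δ = suc d
      H = 2 * δ
      δ+δ≡H : δ + δ ≡ H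
      δ+δ≡H = cong (δ +_) (sym (+-identityʳ δ))
      d+2+d≡H : suc δ + d ≡ H
      d+2+d≡H = trans (sym (+-suc δ d)) δ+δ≡H
    open Walks H
    open Runs H

    walks-centre : ∀ t → walks t (suc k) δ ≡ walks t k (suc δ) + walks t k d
    walks-centre t = cong (_+ walks t k d) (walks↑-< t k (subst (suc δ ≤_) d+2+d≡H (m≤m+n (suc δ) d)))

    -- Reflection makes up for the first step of a deviation set being upwards.
    ζ-even : suc k % 2 ≡ 0 → 2 * ζ (suc k) δ ≤ walks δ (suc k) δ
    ζ-even even = begin
      2 * ζ (suc k) δ                          ≡⟨ cong (ζ (suc k) δ +_) (+-identityʳ _) ⟩
      ζ (suc k) δ + ζ (suc k) δ                ≤⟨ +-mono-≤ bound bound ⟩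
      walks δ k (suc δ) + walks δ k (suc δ)    ≡⟨ cong (walks δ k (suc δ) +_) (walks-reflect k δ+δ≡H d+2+d≡H) ⟩
      walks δ k (suc δ) + walks δ k d          ≡⟨ walks-centre δ ⟨
      walks δ (suc k) δ                        ∎
      where
      open ≤-Reasoning
      bound : ζ (suc k) δ ≤ walks δ k (suc δ)
      bound = ≤-trans (ζ≤ (suc k) δ (runs↑ δ k (suc δ)) λ {α} dev →
          deviation∈runs δ dev (cong (δ +_) (sym (proj₁ (deviation-end {suc k} {δ} {α} dev) even))))
        (≤-reflexive (proj₁ (length-runs δ k (suc δ))))

    -- The walks that begin upwards and end at δ + 1 are reflections of those that begin downwards
    -- and end at d = δ - 1. Joined with the walks that begin upwards and end at d, these are all
    -- walks to d.
    ζ-odd : suc k % 2 ≡ 1 → ζ (suc k) δ ≤ walks d (suc k) δ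
    ζ-odd odd = begin
      ζ (suc k) δ
        ≤⟨ ζ≤ (suc k) δ (runs↑ d k (suc δ) ++ runs↑ (suc δ) k (suc δ)) complete ⟩
      length (runs↑ d k (suc δ) ++ runs↑ (suc δ) k (suc δ))
        ≡⟨ length-++ (runs↑ d k (suc δ)) ⟩
      length (runs↑ d k (suc δ)) + length (runs↑ (suc δ) k (suc δ))
        ≡⟨ cong₂ _+_ (proj₁ (length-runs d k (suc δ))) (proj₁ (length-runs (suc δ) k (suc δ))) ⟩
      walks d k (suc δ) + walks (suc δ) k (suc δ)
        ≡⟨ cong (walks d k (suc δ) +_) (walks-reflect k d+2+d≡H d+2+d≡H) ⟩
      walks d k (suc δ) + walks d k d
        ≡⟨ walks-centre d ⟨
      walks d (suc k) δ ∎
      where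
      open ≤-Reasoning
      complete : ∀ {α} → IsDeviation (suc k) δ α → α ∈ runs↑ d k (suc δ) ++ runs↑ (suc δ) k (suc δ)
      complete {α} dev with proj₂ (deviation-end {suc k} {δ} {α} dev) odd
      ... | inj₁ eq = ∈-++⁺ʳ (runs↑ d k (suc δ)) (deviation∈runs δ dev
        (trans (sym (+-suc δ (sumEven α))) (cong (δ +_) (sym eq))))
      ... | inj₂ eq = ∈-++⁺ˡ (deviation∈runs δ dev
        (trans (cong (d +_) eq) (+-suc d (sumOdd α))))

-- From walk counts to bounds on the size of A

module SizeBounds where

  open import Defs using (IsB; ζ; τ)
  open import Data.Nat
  open import Data.Nat.Properties
  open import Algebra.Properties.CommutativeSemigroup *-commutativeSemigroup using () renaming (x∙yz≈y∙xz to *-swap)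
  open Inequalities
  open SignedSums
  open DeviationSets

  even⊎odd : ∀ k → k % 2 ≡ 0 ⊎ k % 2 ≡ 1
  even⊎odd k with k % 2 | m%n<n k 2
  ... | zero        | _ = inj₁ refl
  ... | suc zero    | _ = inj₂ refl
  ... | suc (suc _) | s≤s (s≤s ())

  -- Integrality: for even k it removes the surplus 1 in 2δn + 1.
  2*-cancel-≤-suc : ∀ {a b} → 2 * a ≤ suc (2 * b) → a ≤ b
  2*-cancel-≤-suc {a} {b} le = s≤s⁻¹ (*-cancelˡ-< 2 a (suc b) (≤-trans (s≤s le) (≤-reflexive (eq b))))
    where
    eq : ∀ b → suc (suc (2 * b)) ≡ 2 * suc b
    eq = solve-∀

  module _ {k′ n d : ℕ} .{{_ : NonZero n}} {a : Fin (suc n)} {A : Subset (suc n)} where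
    private
      k = suc k′
      δ = suc d
      N = ∣ A ∣
      H = 2 * δ
      X = δ * (1 + τ k) * n
      δ≤H : δ ≤ H
      δ≤H = m≤m+n δ (δ + 0)
      1+d<H : suc d < H
      1+d<H = m<m+n δ z<s
    open Walks H

    ζ-binomial-bound : IsB k A → a ∈ˢ A → ζ k δ * (N C k) ≤ X
    ζ-binomial-bound isB a∈A with even⊎odd k
    ... | inj₁ even = 2*-cancel-≤-suc (begin
      2 * (ζ k δ * (N C k))              ≡⟨ *-assoc 2 (ζ k δ) (N C k) ⟨
      2 * ζ k δ * (N C k)                ≤⟨ *-monoˡ-≤ (N C k) (ζ-even d k′ even) ⟩
      walks δ k δ * (N C k)              ≡⟨ *-comm (walks δ k δ) (N C k) ⟩
      (N C k) * walks δ k δ              ≤⟨ walks-bound δ isB a∈A ≤-refl δ≤H ⟩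
      suc (n * H)                        ≡⟨ cong suc (eq n δ) ⟩
      suc (2 * (δ * 1 * n))              ≡⟨ cong (λ t → suc (2 * (δ * (1 + t) * n))) even ⟨
      suc (2 * X)                        ∎)
      where
      open ≤-Reasoning
      eq : ∀ n δ → n * (2 * δ) ≡ 2 * (δ * 1 * n)
      eq = solve-∀
    ... | inj₂ odd = begin
      ζ k δ * (N C k)         ≤⟨ *-monoˡ-≤ (N C k) (ζ-odd d k′ odd) ⟩
      walks d k δ * (N C k)   ≡⟨ *-comm (walks d k δ) (N C k) ⟩
      (N C k) * walks d k δ   ≤⟨ walks-bound-strict d isB a∈A ≤-refl δ≤H 1+d<H ⟩
      n * H                   ≡⟨ eq n δ ⟩
      δ * 2 * n               ≡⟨ cong (λ t → δ * (1 + t) * n) odd ⟨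
      X                       ∎
      where
      open ≤-Reasoning
      eq : ∀ n δ → n * (2 * δ) ≡ δ * 2 * n
      eq = solve-∀

    -- All N elements of A move, so the binomial coefficient is 1. The factor 3 comes from 1 + 2δn ≤
    -- 3δn.
    walks-bound-short : IsB k A → a ∈ˢ A → ∀ t s → suc s + N ≡ k → walks t k δ ≤ 2 * (3 * 2 ^ s * (δ * n))
    walks-bound-short isB a∈A t s eq with walks-drop t (suc s) N δ≤H
    ... | y , y≤H , dropped = begin
      walks t k δ                           ≡⟨ cong (λ j → walks t j δ) eq ⟨
      walks t (suc s + N) δ                 ≤⟨ dropped ⟩
      2 ^ suc s * walks t N y               ≡⟨ cong (2 ^ suc s *_) (*-identityˡ (walks t N y)) ⟨
      2 ^ suc s * (1 * walks t N y)         ≡⟨ cong (λ c → 2 ^ suc s * (c * walks t N y)) (nCn≡1 N) ⟨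
      2 ^ suc s * ((N C N) * walks t N y)
        ≤⟨ *-monoʳ-≤ (2 ^ suc s) (walks-bound t isB a∈A (subst (N ≤_) eq (m≤n+m N (suc s))) y≤H) ⟩
      2 ^ suc s * (1 + n * H)               ≤⟨ *-monoʳ-≤ (2 ^ suc s) (+-monoˡ-≤ (n * H) 1≤δn) ⟩
      2 ^ suc s * (δ * n + n * (2 * δ))     ≡⟨ collect (2 ^ s) δ n ⟩
      2 * (3 * 2 ^ s * (δ * n))             ∎
      where
      open ≤-Reasoning
      1≤δn : 1 ≤ δ * n
      1≤δn = *-mono-≤ (s≤s (z≤n {d})) (>-nonZero⁻¹ n)
      collect : ∀ p δ n → 2 * p * (δ * n + n * (2 * δ)) ≡ 2 * (3 * p * (δ * n))
      collect = solve-∀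

    -- For r = s + 1 dropped steps the loss is 2^r, and rounding 2δn + 1 up to 3δn costs 3/2 more.
    -- Their product 3 * 2^s is at most 3^r, the factor that `pow-descent` recovers.
    ζ-bound-short : IsB k A → a ∈ˢ A → ∀ r .{{_ : NonZero r}} → r + N ≡ k → ζ k δ ≤ 3 ^ r * X
    ζ-bound-short isB a∈A (suc s) eq with even⊎odd k
    ... | inj₁ even = begin
      ζ k δ                       ≤⟨ *-cancelˡ-≤ 2 (≤-trans (ζ-even d k′ even) (walks-bound-short isB a∈A δ s eq)) ⟩
      3 * 2 ^ s * (δ * n)         ≤⟨ *-monoˡ-≤ (δ * n) (*-monoʳ-≤ 3 (^-monoˡ-≤ s (n≤1+n 2))) ⟩
      3 ^ suc s * (δ * n)         ≡⟨ cong (λ t → 3 ^ suc s * (t * n)) (*-identityʳ δ) ⟨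
      3 ^ suc s * (δ * 1 * n)     ≡⟨ cong (λ t → 3 ^ suc s * (δ * (1 + t) * n)) even ⟨
      3 ^ suc s * X               ∎
      where open ≤-Reasoning
    ... | inj₂ odd = begin
      ζ k δ                       ≤⟨ ≤-trans (ζ-odd d k′ odd) (walks-bound-short isB a∈A d s eq) ⟩
      2 * (3 * 2 ^ s * (δ * n))   ≡⟨ rearrange (3 * 2 ^ s) δ n ⟩
      3 * 2 ^ s * (δ * 2 * n)     ≤⟨ *-monoˡ-≤ (δ * 2 * n) (*-monoʳ-≤ 3 (^-monoˡ-≤ s (n≤1+n 2))) ⟩
      3 ^ suc s * (δ * 2 * n)     ≡⟨ cong (λ t → 3 ^ suc s * (δ * (1 + t) * n)) odd ⟨
      3 ^ suc s * X               ∎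
      where
      open ≤-Reasoning
      rearrange : ∀ p δ n → 2 * (p * (δ * n)) ≡ p * (δ * 2 * n)
      rearrange = solve-∀

  C-factorials : ∀ d k → ((d + k) C k) * (k ! * d !) ≡ (d + k) !
  C-factorials d k = subst (λ e → ((d + k) C k) * (k ! * e !) ≡ (d + k) !) (m+n∸n≡m d k)
    (trans (cong (_* (k ! * (d + k ∸ k) !)) (nCk≡n!/k![n-k]! k≤d+k)) (m/n*n≡m (k![n∸k]!∣n! k≤d+k)))
    where
    k≤d+k = m≤n+m k d
    instance
      nz = m*n≢0 (k !) ((d + k ∸ k) !) {{k !≢0}} {{(d + k ∸ k) !≢0}}

  -- w / expNumerator k is max(0, N - k + k/E), E being the k-th partial sum of e.
  root-argument : ℕ → ℕ → ℕ
  root-argument k N = N * expNumerator k + k * k ! ∸ k * expNumerator k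

  module _ (k δ n N : ℕ) .{{_ : NonZero k}} where
    private
      G = expNumerator k
      X = δ * (1 + τ k) * n
      w = root-argument k N
      Goal : Set
      Goal = ζ k δ * w ^ k ≤ G ^ k * (X * k !)

      w≡0 : w ≡ 0 → Goal
      w≡0 eq = ≤-trans (≤-reflexive (trans (cong (λ v → ζ k δ * v ^ k) eq)
        (trans (cong (ζ k δ *_) (0^ k)) (*-zeroʳ (ζ k δ))))) z≤n
        where
        0^ : ∀ k .{{_ : NonZero k}} → 0 ^ k ≡ 0
        0^ (suc k) = refl

    size-bound-empty : N ≡ 0 → Goal
    size-bound-empty N≡0 = w≡0 (trans (cong (λ M → M * G + k * k ! ∸ k * G) N≡0)
      (m≤n⇒m∸n≡0 (*-monoʳ-≤ k (m≤m+n (k !) (expTail k)))))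

    size-bound-long : ∀ d → N ≡ d + k → ζ k δ * (N C k) ≤ X → Goal
    size-bound-long d N≡d+k bound = *-cancelʳ-≤ _ _ (d !) {{d !≢0}} (begin
      ζ k δ * w ^ k * d !                ≡⟨ *-assoc (ζ k δ) (w ^ k) (d !) ⟩
      ζ k δ * (w ^ k * d !)              ≡⟨ cong (λ v → ζ k δ * (v ^ k * d !)) w≡ ⟩
      ζ k δ * ((d * G + k * k !) ^ k * d !)
        ≤⟨ *-monoʳ-≤ (ζ k δ) (pow≤factorial k {k} d ≤-refl) ⟩
      ζ k δ * (G ^ k * (d + k) !)        ≡⟨ cong (λ f → ζ k δ * (G ^ k * f)) (C-factorials d k) ⟨
      ζ k δ * (G ^ k * (((d + k) C k) * (k ! * d !)))
        ≡⟨ rearrange (ζ k δ) (G ^ k) ((d + k) C k) (k !) (d !) ⟩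
      G ^ k * (ζ k δ * ((d + k) C k) * k !) * d !
        ≡⟨ cong (λ M → G ^ k * (ζ k δ * (M C k) * k !) * d !) N≡d+k ⟨
      G ^ k * (ζ k δ * (N C k) * k !) * d !
        ≤⟨ *-monoˡ-≤ (d !) (*-monoʳ-≤ (G ^ k) (*-monoˡ-≤ (k !) bound)) ⟩
      G ^ k * (X * k !) * d ! ∎)
      where
      open ≤-Reasoning
      rearrange : ∀ z g c f e → z * (g * (c * (f * e))) ≡ g * (z * c * f) * e
      rearrange = solve-∀
      shift : ∀ d k G f → (d + k) * G + f ≡ d * G + f + k * G
      shift = solve-∀
      w≡ : w ≡ d * G + k * k !
      w≡ = trans (cong (λ M → M * G + k * k ! ∸ k * G) N≡d+k)
        (trans (cong (_∸ k * G) (shift d k G (k * k !))) (m+n∸n≡m _ (k * G)))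

    size-bound-short : ∀ r → r + N ≡ k → ζ k δ ≤ 3 ^ r * X → Goal
    size-bound-short r r+N≡k bound with ≤-total (k * k !) (r * G)
    ... | inj₁ le = w≡0 (m≤n⇒m∸n≡0 (begin
      N * G + k * k !  ≤⟨ +-monoʳ-≤ (N * G) le ⟩
      N * G + r * G    ≡⟨ +-comm (N * G) (r * G) ⟩
      r * G + N * G    ≡⟨ *-distribʳ-+ G r N ⟨
      (r + N) * G      ≡⟨ cong (_* G) r+N≡k ⟩
      k * G            ∎))
      where open ≤-Reasoning
    ... | inj₂ le = begin
      ζ k δ * w ^ k              ≤⟨ *-monoˡ-≤ (w ^ k) bound ⟩
      3 ^ r * X * w ^ k          ≡⟨ rearrange (3 ^ r) X (w ^ k) ⟩
      X * (3 ^ r * w ^ k)        ≤⟨ *-monoʳ-≤ X (pow-descent k {k} r w w+rG≡) ⟩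
      X * (k * k !) ^ k          ≡⟨ cong (X *_) (*-identityʳ ((k * k !) ^ k)) ⟨
      -- Case d = 0, that is (k/E)^k ≤ k!.
      X * ((0 * G + k * k !) ^ k * 0 !) ≤⟨ *-monoʳ-≤ X (pow≤factorial k {k} 0 ≤-refl) ⟩
      X * (G ^ k * k !)          ≡⟨ *-swap X (G ^ k) (k !) ⟩
      G ^ k * (X * k !)          ∎
      where
      open ≤-Reasoning
      rearrange : ∀ p x q → p * x * q ≡ x * (p * q)
      rearrange = solve-∀
      w+rG≡ : w + r * G ≡ k * k !
      w+rG≡ = begin-equality
        w + r * G
          ≡⟨ cong (λ v → N * G + k * k ! ∸ v * G + r * G) (trans (sym r+N≡k) (+-comm r N)) ⟩
        N * G + k * k ! ∸ (N + r) * G + r * G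
          ≡⟨ cong (λ v → N * G + k * k ! ∸ v + r * G) (*-distribʳ-+ G N r) ⟩
        N * G + k * k ! ∸ (N * G + r * G) + r * G
          ≡⟨ cong (_+ r * G) ([m+n]∸[m+o]≡n∸o (N * G) (k * k !) (r * G)) ⟩
        k * k ! ∸ r * G + r * G
          ≡⟨ m∸n+n≡m le ⟩
        k * k ! ∎

  -- The empty set is treated apart because padding in `isB-multiplicities` takes an element of A.
  size-bound : ∀ {n} .{{_ : NonZero n}} k δ .{{_ : NonZero k}} .{{_ : NonZero δ}} {A : Subset (suc n)} → IsB k A →
    ζ k δ * root-argument k ∣ A ∣ ^ k ≤ expNumerator k ^ k * (δ * (1 + τ k) * n * k !)
  size-bound {n} k@(suc _) δ@(suc _) {A} isB with nonempty? A | ≤-total k ∣ A ∣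
  ... | no  empty     | _ = size-bound-empty k δ n ∣ A ∣ (trans (cong ∣_∣ (Empty-unique empty)) (∣⊥∣≡0 (suc n)))
  ... | yes (a , a∈A) | inj₁ k≤N = size-bound-long k δ n ∣ A ∣ (∣ A ∣ ∸ k) (sym (m∸n+n≡m k≤N)) (ζ-binomial-bound isB a∈A)
  ... | yes (a , a∈A) | inj₂ N≤k with k ∸ ∣ A ∣ in eq | m∸n+n≡m N≤k
  -- The factor 3/2 lost in `ζ-bound-short` fits into 3^r only for r ≥ 1, so N = k counts as long,
  -- with d = 0.
  ...   | zero  | N≡k = size-bound-long k δ n ∣ A ∣ 0 N≡k (ζ-binomial-bound isB a∈A)
  ...   | suc s | r+N≡k = size-bound-short k δ n ∣ A ∣ (suc s) r+N≡k (ζ-bound-short isB a∈A (suc s) r+N≡k)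

-- Passage to the real numbers

module Limits where

  open import Defs using (IsB; isB?; subsets; ζ; ζ-nonZero; τ; Φ; rootNumerator; rootNumerator-above;
    rootNumerator-below; root; e; partialSum; recip; ℕ→ℝ; e#0)
  import Defs as R
  open import Data.Nat
  open import Data.Nat.Properties
  open import Data.Rational as ℚ using (ℚ; mkℚ; 0ℚ; 1ℚ; ↥_; ↧_; ↧ₙ_)
  open Inequalities
  open SizeBounds

  ι : ℕ → ℚ
  ι n = ℤ.+ n ℚ./ 1

  toℚᵘ-ι : ∀ n → ℚ.toℚᵘ (ι n) ℚᵘ.≃ mkℚᵘ (ℤ.+ n) 0
  toℚᵘ-ι n = ℚ.toℚᵘ-fromℚᵘ (mkℚᵘ (ℤ.+ n) 0)

  ι-+ : ∀ m n → ι (m + n) ≡ ι m ℚ.+ ι n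
  ι-+ m n = ℚ.toℚᵘ-injective (ℚᵘ.≃-trans (toℚᵘ-ι (m + n)) (ℚᵘ.≃-trans (ℚᵘ.*≡* eq)
    (ℚᵘ.≃-sym (ℚᵘ.≃-trans (ℚ.toℚᵘ-homo-+ (ι m) (ι n)) (ℚᵘ.+-cong (toℚᵘ-ι m) (toℚᵘ-ι n))))))
    where
    eq : ℤ.+ (m + n) ℤ.* ℤ.1ℤ ≡ (ℤ.+ m ℤ.* ℤ.1ℤ ℤ.+ ℤ.+ n ℤ.* ℤ.1ℤ) ℤ.* ℤ.1ℤ
    eq = cong (ℤ._* ℤ.1ℤ) (cong₂ ℤ._+_ (sym (ℤ.*-identityʳ (ℤ.+ m))) (sym (ℤ.*-identityʳ (ℤ.+ n))))

  ι-* : ∀ m n → ι (m * n) ≡ ι m ℚ.* ι n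
  ι-* m n = ℚ.toℚᵘ-injective (ℚᵘ.≃-trans (toℚᵘ-ι (m * n)) (ℚᵘ.≃-trans
    (ℚᵘ.*≡* (cong (ℤ._* ℤ.1ℤ) (ℤ.pos-* m n)))
    (ℚᵘ.≃-sym (ℚᵘ.≃-trans (ℚ.toℚᵘ-homo-* (ι m) (ι n)) (ℚᵘ.*-cong (toℚᵘ-ι m) (toℚᵘ-ι n))))))

  ι-mono : ∀ {m n} → m ≤ n → ι m ℚ.≤ ι n
  ι-mono {m} {n} m≤n = ℚ.toℚᵘ-cancel-≤ (ℚᵘ.≤-trans (ℚᵘ.≤-reflexive (toℚᵘ-ι m)) (ℚᵘ.≤-trans
    (ℚᵘ.*≤* (ℤ.*-monoʳ-≤-nonNeg ℤ.1ℤ (ℤ.+≤+ m≤n)))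
    (ℚᵘ.≤-reflexive (ℚᵘ.≃-sym (toℚᵘ-ι n)))))

  ι-nonNegative : ∀ n → ℚ.NonNegative (ι n)
  ι-nonNegative n = ℚ.nonNegative (ι-mono {0} {n} z≤n)

  ι-positive : ∀ n .{{_ : NonZero n}} → ℚ.Positive (ι n)
  ι-positive n = ℚ.positive (ℚ.<-≤-trans (ℚ.positive⁻¹ 1ℚ) (ι-mono {1} {n} (>-nonZero⁻¹ n)))

  /-cancel : ∀ i d .{{_ : NonZero d}} → (i ℚ./ d) ℚ.* ι d ≡ i ℚ./ 1
  /-cancel i (suc d) = ℚ.toℚᵘ-injective (ℚᵘ.≃-trans (ℚ.toℚᵘ-homo-* (i ℚ./ suc d) (ι (suc d)))
    (ℚᵘ.≃-trans (ℚᵘ.*-cong (ℚ.toℚᵘ-fromℚᵘ (mkℚᵘ i d)) (toℚᵘ-ι (suc d)))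
    (ℚᵘ.≃-trans (ℚᵘ.*≡* eq) (ℚᵘ.≃-sym (ℚ.toℚᵘ-fromℚᵘ (mkℚᵘ i 0))))))
    where
    eq : i ℤ.* ℤ.+ suc d ℤ.* ℤ.1ℤ ≡ i ℤ.* (ℤ.+ suc d ℤ.* ℤ.1ℤ)
    eq = ℤ.*-assoc i (ℤ.+ suc d) ℤ.1ℤ

  /-nonNegative : ∀ a d .{{_ : NonZero d}} → 0ℚ ℚ.≤ ℤ.+ a ℚ./ d
  /-nonNegative a d = ℚ.*-cancelʳ-≤-pos (ι d) {{ι-positive d}}
    (subst₂ ℚ._≤_ (sym (ℚ.*-zeroˡ (ι d))) (sym (/-cancel (ℤ.+ a) d)) (ι-mono {0} {a} z≤n))

  expNumerator-suc : ∀ l → expNumerator (suc l) ≡ suc l * expNumerator l + 1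
  expNumerator-suc l = eq l (l !) (expTail l)
    where
    eq : ∀ l f K → suc l * f + (suc l * K + 1) ≡ suc l * (f + K) + 1
    eq = solve-∀

  partialSum-numerator : ∀ l → partialSum l ℚ.* ι (l !) ≡ ι (expNumerator l)
  partialSum-numerator zero    = refl
  partialSum-numerator (suc l) = begin
    (partialSum l ℚ.+ t) ℚ.* ι (suc l !)
      ≡⟨ ℚ.*-distribʳ-+ (ι (suc l !)) (partialSum l) t ⟩
    partialSum l ℚ.* ι (suc l * l !) ℚ.+ t ℚ.* ι (suc l !)
      ≡⟨ cong₂ (λ x y → partialSum l ℚ.* x ℚ.+ y) (ι-* (suc l) (l !)) (/-cancel (ℤ.+ 1) (suc l !) {{suc l !≢0}}) ⟩
    partialSum l ℚ.* (ι (suc l) ℚ.* ι (l !)) ℚ.+ ι 1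
      ≡⟨ cong (ℚ._+ ι 1) (solve 3 (λ p s f → p :* (s :* f) := s :* (p :* f)) refl (partialSum l) (ι (suc l)) (ι (l !))) ⟩
    ι (suc l) ℚ.* (partialSum l ℚ.* ι (l !)) ℚ.+ ι 1
      ≡⟨ cong (λ x → ι (suc l) ℚ.* x ℚ.+ ι 1) (partialSum-numerator l) ⟩
    ι (suc l) ℚ.* ι (expNumerator l) ℚ.+ ι 1
      ≡⟨ cong (ℚ._+ ι 1) (ι-* (suc l) (expNumerator l)) ⟨
    ι (suc l * expNumerator l) ℚ.+ ι 1
      ≡⟨ ι-+ (suc l * expNumerator l) 1 ⟨
    ι (suc l * expNumerator l + 1)
      ≡⟨ cong ι (expNumerator-suc l) ⟨
    ι (expNumerator (suc l)) ∎
    where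
    open ≡-Reasoning
    open +-*-Solver using (solve; _:*_; _:=_)
    t = (ℤ.+ 1 ℚ./ (suc l !)) {{suc l !≢0}}

  partialSum-≤ : ∀ {l m} → l ≤′ m → partialSum l ℚ.≤ partialSum m
  partialSum-≤ (≤′-reflexive refl) = ℚ.≤-refl
  partialSum-≤ {l} {suc m} (≤′-step l≤m) = ℚ.≤-trans (partialSum-≤ {l} {m} l≤m)
    (subst (ℚ._≤ partialSum (suc m)) (ℚ.+-identityʳ (partialSum m))
      (ℚ.+-monoʳ-≤ (partialSum m) (/-nonNegative 1 (suc m !) {{suc m !≢0}})))

  partialSum-positive : ∀ m → ℚ.Positive (partialSum m)
  partialSum-positive m = ℚ.positive (ℚ.<-≤-trans (ℚ.positive⁻¹ 1ℚ) (partialSum-≤ {0} {m} (≤⇒≤′ z≤n)))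

  recip-inverseˡ : ∀ q .{{_ : ℚ.Positive q}} → recip q ℚ.* q ≡ 1ℚ
  recip-inverseˡ q with q ℚ.≟ 0ℚ
  ... | yes refl = contradiction (ℚ.positive⁻¹ 0ℚ) (ℚ.<-irrefl refl)
  ... | no  q≢0  = ℚ.*-inverseˡ q {{ℚ.≢-nonZero q≢0}}

  recip-nonNegative : ∀ q .{{_ : ℚ.Positive q}} → 0ℚ ℚ.≤ recip q
  recip-nonNegative q = ℚ.*-cancelʳ-≤-pos q (subst₂ ℚ._≤_ (sym (ℚ.*-zeroˡ q)) (sym (recip-inverseˡ q))
    (ℚ.<⇒≤ (ℚ.positive⁻¹ 1ℚ)))

  -- Partial sums of e increase, so 1/E_m ≤ 1/E_k: the bound obtained with E_k survives at every
  -- later index of the sequence `e`.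
  recip-partialSum : ∀ {k m} → k ≤ m → recip (partialSum m) ℚ.* ι (expNumerator k) ℚ.≤ ι (k !)
  recip-partialSum {k} {m} k≤m = begin
    R ℚ.* ι (expNumerator k)          ≡⟨ cong (R ℚ.*_) (partialSum-numerator k) ⟨
    R ℚ.* (partialSum k ℚ.* ι (k !))
      ≤⟨ ℚ.*-monoˡ-≤-nonNeg R (ℚ.*-monoʳ-≤-nonNeg (ι (k !)) {{ι-nonNegative (k !)}} (partialSum-≤ {k} {m} (≤⇒≤′ k≤m))) ⟩
    R ℚ.* (P ℚ.* ι (k !))             ≡⟨ ℚ.*-assoc R P (ι (k !)) ⟨
    R ℚ.* P ℚ.* ι (k !)               ≡⟨ cong (ℚ._* ι (k !)) (recip-inverseˡ P) ⟩
    1ℚ ℚ.* ι (k !)                    ≡⟨ ℚ.*-identityˡ (ι (k !)) ⟩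
    ι (k !)                           ∎
    where
    open ℚ.≤-Reasoning
    P = partialSum m
    R = recip P
    instance
      P>0 : ℚ.Positive P
      P>0 = partialSum-positive m
      R≥0 : ℚ.NonNegative R
      R≥0 = ℚ.nonNegative (recip-nonNegative P)

  archimedean : ∀ c {ε} → 0ℚ ℚ.< ε → ∃[ n ] ∀ {m} → n ≤ m → ι c ℚ.≤ ε ℚ.* ι m
  archimedean c {mkℚ (ℤ.+ zero) d _}   (ℚ.*<* (ℤ.+<+ ()))
  archimedean c {mkℚ ℤ.-[1+ n ] d _} (ℚ.*<* ())
  archimedean c {ε@(mkℚ (ℤ.+ suc p) d _)} 0<ε = suc d * c , λ {m} le → begin
    ι c                         ≤⟨ ι-mono {c} {suc p * c} (m≤n*m c (suc p)) ⟩
    ι (suc p * c)               ≡⟨ ι-* (suc p) c ⟩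
    ι (suc p) ℚ.* ι c           ≡⟨ cong (ℚ._* ι c) (/-cancel (ℤ.+ suc p) (suc d)) ⟨
    (ℤ.+ suc p ℚ./ suc d) ℚ.* ι (suc d) ℚ.* ι c
                                ≡⟨ cong (λ q → q ℚ.* ι (suc d) ℚ.* ι c) (ℚ.↥p/↧p≡p ε) ⟩
    ε ℚ.* ι (suc d) ℚ.* ι c     ≡⟨ ℚ.*-assoc ε (ι (suc d)) (ι c) ⟩
    ε ℚ.* (ι (suc d) ℚ.* ι c)   ≡⟨ cong (ε ℚ.*_) (ι-* (suc d) c) ⟨
    ε ℚ.* ι (suc d * c)         ≤⟨ ℚ.*-monoˡ-≤-nonNeg ε (ι-mono {suc d * c} {m} le) ⟩
    ε ℚ.* ι m                   ∎
    where open ℚ.≤-Reasoning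

  pow-distrib-* : ∀ a b k → (a * b) ^ k ≡ a ^ k * b ^ k
  pow-distrib-* a b zero    = refl
  pow-distrib-* a b (suc k) = trans (cong (a * b *_) (pow-distrib-* a b k))
    ([m*n]*[o*p]≡[m*o]*[n*p] a b (a ^ k) (b ^ k))

  numerator : ℚ → ℕ
  numerator q = ℤ.∣ ↥ q ∣

  -- Since `/` reduces fractions, the numerator is determined only through cross-multiplication.
  numerator-/ : ∀ i n .{{_ : NonZero n}} → numerator (ℤ.+ i ℚ./ n) * n ≡ i * ↧ₙ (ℤ.+ i ℚ./ n)
  numerator-/ i n = begin
    ℤ.∣ ↥ q ∣ * n                   ≡⟨ ℤ.abs-* (↥ q) (ℤ.+ n) ⟨
    ℤ.∣ ↥ q ℤ.* ℤ.+ n ∣             ≡⟨ cong (λ x → ℤ.∣ ↥ q ℤ.* x ∣) (ℚ.↧-/ (ℤ.+ i) n) ⟨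
    ℤ.∣ ↥ q ℤ.* (↧ q ℤ.* g) ∣       ≡⟨ cong (λ x → ℤ.∣ ↥ q ℤ.* x ∣) (ℤ.*-comm (↧ q) g) ⟩
    ℤ.∣ ↥ q ℤ.* (g ℤ.* ↧ q) ∣       ≡⟨ cong ℤ.∣_∣ (ℤ.*-assoc (↥ q) g (↧ q)) ⟨
    ℤ.∣ ↥ q ℤ.* g ℤ.* ↧ q ∣         ≡⟨ cong (λ x → ℤ.∣ x ℤ.* ↧ q ∣) (ℚ.↥-/ (ℤ.+ i) n) ⟩
    ℤ.∣ ℤ.+ i ℤ.* ↧ q ∣             ≡⟨ ℤ.abs-* (ℤ.+ i) (↧ q) ⟩
    i * ↧ₙ q                        ∎
    where
    open ≡-Reasoning
    q = ℤ.+ i ℚ./ n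
    g = ℤ.gcd (ℤ.+ i) (ℤ.+ n)

  rootNumerator-lower : ∀ k .{{_ : NonZero k}} q m →
    numerator q * suc m ^ k < suc (rootNumerator k q m) ^ k * ↧ₙ q
  rootNumerator-lower k q m = ≰⇒> (rootNumerator-above k q m)

  -- Crude but linear in `suc m`, which makes the error in a product of two truncated roots of order
  -- 1/m.
  rootNumerator-upper : ∀ k .{{_ : NonZero k}} q m → rootNumerator k q m < suc (numerator q) * suc m
  rootNumerator-upper k q m = ≰⇒> λ le → <⇒≱ (begin-strict
    numerator q * suc m ^ k                      <⟨ *-monoˡ-< (suc m ^ k) {{m^n≢0 (suc m) k}} (n<1+n (numerator q)) ⟩
    suc (numerator q) * suc m ^ k                ≤⟨ *-monoˡ-≤ (suc m ^ k) (n≤n^k (suc (numerator q)) k) ⟩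
    suc (numerator q) ^ k * suc m ^ k            ≡⟨ pow-distrib-* (suc (numerator q)) (suc m) k ⟨
    (suc (numerator q) * suc m) ^ k              ≤⟨ ^-monoˡ-≤ k le ⟩
    rootNumerator k q m ^ k                      ≤⟨ m≤m*n _ (↧ₙ q) ⟩
    rootNumerator k q m ^ k * ↧ₙ q               ∎)
    (rootNumerator-below k q m)
    where
    open ≤-Reasoning
    n≤n^k : ∀ n k .{{_ : NonZero n}} .{{_ : NonZero k}} → n ≤ n ^ k
    n≤n^k n (suc k) = m≤m*n n (n ^ k) {{m^n≢0 n k}}

  -- With p₁/d₁ = x/ζ and p₂/d₂ = n, the fractions a/M and b/M exceed the two k-th roots, so
  -- (ab/M²)^k ≥ xn/ζ ≥ (w/G)^k. The exponent k is removed by contradiction, from strict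
  -- monotonicity of powers.
  root-product-lower : ∀ {k G w x ζ n a b p₁ d₁ p₂ d₂} M .{{_ : NonZero k}} .{{_ : NonZero ζ}}
    .{{_ : NonZero d₁}} .{{_ : NonZero d₂}} →
    ζ * w ^ k ≤ G ^ k * (x * n) → p₁ * ζ ≡ x * d₁ → p₂ ≡ n * d₂ →
    p₁ * M ^ k < a ^ k * d₁ → p₂ * M ^ k < b ^ k * d₂ → w * (M * M) ≤ G * (a * b)
  root-product-lower {k} {G} {w} {x} {ζ} {n} {a} {b} {p₁} {d₁} {p₂} {d₂} M bound eq₁ eq₂ lt₁ lt₂ = ≮⇒≥ λ lt →
    <-irrefl refl (begin-strict
      D * (G * (a * b)) ^ k
        <⟨ *-monoʳ-< D {{D≢0}} (^-monoˡ-< k lt) ⟩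
      D * (w * (M * M)) ^ k
        ≡⟨ cong (D *_) (trans (pow-distrib-* w (M * M) k) (cong (w ^ k *_) (pow-distrib-* M M k))) ⟩
      D * (w ^ k * (M ^ k * M ^ k))
        ≡⟨ r₁ ζ (d₁ * d₂) (w ^ k) (M ^ k) ⟩
      ζ * w ^ k * (d₁ * d₂ * (M ^ k * M ^ k))
        ≤⟨ *-monoˡ-≤ _ bound ⟩
      G ^ k * (x * n) * (d₁ * d₂ * (M ^ k * M ^ k))
        ≡⟨ r₂ (G ^ k) x n d₁ d₂ (M ^ k) ⟩
      G ^ k * ((x * d₁) * (n * d₂) * (M ^ k * M ^ k))
        ≡⟨ cong₂ (λ s t → G ^ k * (s * t * (M ^ k * M ^ k))) eq₁ eq₂ ⟨
      G ^ k * (p₁ * ζ * p₂ * (M ^ k * M ^ k))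
        ≡⟨ r₃ (G ^ k) p₁ ζ p₂ (M ^ k) ⟩
      G ^ k * (ζ * ((p₁ * M ^ k) * (p₂ * M ^ k)))
        ≤⟨ *-monoʳ-≤ (G ^ k) (*-monoʳ-≤ ζ (*-mono-≤ (<⇒≤ lt₁) (<⇒≤ lt₂))) ⟩
      G ^ k * (ζ * ((a ^ k * d₁) * (b ^ k * d₂)))
        ≡⟨ r₄ (G ^ k) ζ (a ^ k) d₁ (b ^ k) d₂ ⟩
      D * (G ^ k * (a ^ k * b ^ k))
        ≡⟨ cong (D *_) (trans (pow-distrib-* G (a * b) k) (cong (G ^ k *_) (pow-distrib-* a b k))) ⟨
      D * (G * (a * b)) ^ k ∎)
    where
    open ≤-Reasoning
    D = ζ * (d₁ * d₂)
    D≢0 : NonZero D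
    D≢0 = m*n≢0 ζ (d₁ * d₂)
      where instance d₁d₂≢0 = m*n≢0 d₁ d₂
    r₁ : ∀ z d w m → z * d * (w * (m * m)) ≡ z * w * (d * (m * m))
    r₁ = solve-∀
    r₂ : ∀ g x n d e m → g * (x * n) * (d * e * (m * m)) ≡ g * ((x * d) * (n * e) * (m * m))
    r₂ = solve-∀
    r₃ : ∀ g p z q m → g * (p * z * q * (m * m)) ≡ g * (z * ((p * m) * (q * m)))
    r₃ = solve-∀
    r₄ : ∀ g z a d b e → g * (z * ((a * d) * (b * e))) ≡ z * (d * e) * (g * (a * b))
    r₄ = solve-∀

  -- The comparison at one index. `sizes` and R ≤ F/G give N ≤ w/G + k - kR, where k - kR = (P -
  -- 1)Rk. By `lower`, w/G ≤ (a+1)(b+1)/M², and lowering this to ab/M² = rs costs (a+b+1)/M² ≤ ε.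
  -- All is multiplied by G M² to use the hypotheses on natural numbers.
  rational-bound : ∀ {N k G F w a b M P R r s ε} .{{_ : NonZero G}} .{{_ : NonZero M}} →
    R ℚ.* P ≡ 1ℚ → R ℚ.* ι G ℚ.≤ ι F → r ℚ.* ι M ≡ ι a → s ℚ.* ι M ≡ ι b →
    N * G + k * F ≤ w + k * G → w * (M * M) ≤ G * (suc a * suc b) → ι (a + suc b) ℚ.≤ ε ℚ.* ι (M * M) →
    ι N ℚ.≤ r ℚ.* s ℚ.+ (P ℚ.- ι 1) ℚ.* R ℚ.* ι k ℚ.+ ε
  rational-bound {N} {k} {G} {F} {w} {a} {b} {M} {P} {R} {r} {s} {ε} RP RG rM sM sizes lower small = begin
    ι N
      ≡⟨ solve 2 (λ n x → n := n :+ x :- x) refl (ι N) (R ℚ.* ι k) ⟩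
    ι N ℚ.+ R ℚ.* ι k ℚ.- R ℚ.* ι k
      ≤⟨ ℚ.+-monoˡ-≤ (ℚ.- (R ℚ.* ι k)) unscaled ⟩
    r ℚ.* s ℚ.+ ε ℚ.+ ι k ℚ.- R ℚ.* ι k
      ≡⟨ cong (λ x → r ℚ.* s ℚ.+ ε ℚ.+ x ℚ.- R ℚ.* ι k) (trans (cong (ℚ._* ι k) RP) (ℚ.*-identityˡ (ι k))) ⟨
    r ℚ.* s ℚ.+ ε ℚ.+ R ℚ.* P ℚ.* ι k ℚ.- R ℚ.* ι k
      ≡⟨ cong (λ x → r ℚ.* s ℚ.+ ε ℚ.+ R ℚ.* P ℚ.* ι k ℚ.- x ℚ.* ι k) (ℚ.*-identityˡ R) ⟨
    r ℚ.* s ℚ.+ ε ℚ.+ R ℚ.* P ℚ.* ι k ℚ.- ι 1 ℚ.* R ℚ.* ι k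
      ≡⟨ solve 7 (λ r s e R P k u → r :* s :+ e :+ R :* P :* k :- u :* R :* k :=
           r :* s :+ (P :- u) :* R :* k :+ e) refl r s ε R P (ι k) (ι 1) ⟩
    r ℚ.* s ℚ.+ (P ℚ.- ι 1) ℚ.* R ℚ.* ι k ℚ.+ ε ∎
    where
    open ℚ.≤-Reasoning
    open +-*-Solver using (solve; _:+_; _:-_; _:*_; _:=_)
    nz : NonZero (G * (M * M))
    nz = m*n≢0 G (M * M)
      where instance M²≢0 = m*n≢0 M M
    expanded : N * (G * (M * M)) + F * (k * (M * M)) ≤ G * (a * b) + G * (a + suc b) + k * (G * (M * M))
    expanded = ≤-trans (≤-reflexive (e₁ N G k F (M * M))) (≤-trans (*-monoˡ-≤ (M * M) sizes)
      (≤-trans (≤-reflexive (e₂ w k G (M * M))) (≤-trans (+-monoˡ-≤ (k * (G * (M * M))) lower)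
        (≤-reflexive (cong (_+ k * (G * (M * M))) (e₃ G a b))))))
      where
      e₁ : ∀ N G k F m → N * (G * m) + F * (k * m) ≡ (N * G + k * F) * m
      e₁ = solve-∀
      e₂ : ∀ w k G m → (w + k * G) * m ≡ w * m + k * (G * m)
      e₂ = solve-∀
      e₃ : ∀ G a b → G * (suc a * suc b) ≡ G * (a * b) + G * (a + suc b)
      e₃ = solve-∀
    scaled : (ι N ℚ.+ R ℚ.* ι k) ℚ.* ι (G * (M * M)) ℚ.≤ (r ℚ.* s ℚ.+ ε ℚ.+ ι k) ℚ.* ι (G * (M * M))
    scaled = begin
      (ι N ℚ.+ R ℚ.* ι k) ℚ.* ι (G * (M * M))
        ≡⟨ cong ((ι N ℚ.+ R ℚ.* ι k) ℚ.*_) (ι-* G (M * M)) ⟩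
      (ι N ℚ.+ R ℚ.* ι k) ℚ.* (ι G ℚ.* ι (M * M))
        ≡⟨ solve 5 (λ n R k g m → (n :+ R :* k) :* (g :* m) := n :* (g :* m) :+ R :* g :* (k :* m)) refl
             (ι N) R (ι k) (ι G) (ι (M * M)) ⟩
      ι N ℚ.* (ι G ℚ.* ι (M * M)) ℚ.+ R ℚ.* ι G ℚ.* (ι k ℚ.* ι (M * M))
        ≡⟨ cong₂ (λ x y → x ℚ.+ R ℚ.* ι G ℚ.* y)
             (trans (cong (ι N ℚ.*_) (sym (ι-* G (M * M)))) (sym (ι-* N (G * (M * M)))))
             (sym (ι-* k (M * M))) ⟩
      ι (N * (G * (M * M))) ℚ.+ R ℚ.* ι G ℚ.* ι (k * (M * M))
        ≤⟨ ℚ.+-monoʳ-≤ (ι (N * (G * (M * M)))) (ℚ.*-monoʳ-≤-nonNeg (ι (k * (M * M))) {{ι-nonNegative (k * (M * M))}} RG) ⟩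
      ι (N * (G * (M * M))) ℚ.+ ι F ℚ.* ι (k * (M * M))
        ≡⟨ cong (ι (N * (G * (M * M))) ℚ.+_) (sym (ι-* F (k * (M * M)))) ⟩
      ι (N * (G * (M * M))) ℚ.+ ι (F * (k * (M * M)))
        ≡⟨ ι-+ (N * (G * (M * M))) (F * (k * (M * M))) ⟨
      ι (N * (G * (M * M)) + F * (k * (M * M)))
        ≤⟨ ι-mono {N * (G * (M * M)) + F * (k * (M * M))} {G * (a * b) + G * (a + suc b) + k * (G * (M * M))} expanded ⟩
      ι (G * (a * b) + G * (a + suc b) + k * (G * (M * M)))
        ≡⟨ trans (ι-+ (G * (a * b) + G * (a + suc b)) (k * (G * (M * M))))
             (cong₂ ℚ._+_ (trans (ι-+ (G * (a * b)) (G * (a + suc b)))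
               (cong₂ ℚ._+_ (trans (ι-* G (a * b)) (cong (ι G ℚ.*_) (ι-* a b))) (ι-* G (a + suc b))))
             (ι-* k (G * (M * M)))) ⟩
      ι G ℚ.* (ι a ℚ.* ι b) ℚ.+ ι G ℚ.* ι (a + suc b) ℚ.+ ι k ℚ.* ι (G * (M * M))
        ≤⟨ ℚ.+-monoˡ-≤ (ι k ℚ.* ι (G * (M * M))) (ℚ.+-monoʳ-≤ (ι G ℚ.* (ι a ℚ.* ι b))
             (ℚ.*-monoˡ-≤-nonNeg (ι G) {{ι-nonNegative G}} small)) ⟩
      ι G ℚ.* (ι a ℚ.* ι b) ℚ.+ ι G ℚ.* (ε ℚ.* ι (M * M)) ℚ.+ ι k ℚ.* ι (G * (M * M))
        ≡⟨ cong₂ (λ x y → ι G ℚ.* (x ℚ.* y) ℚ.+ ι G ℚ.* (ε ℚ.* ι (M * M)) ℚ.+ ι k ℚ.* ι (G * (M * M))) rM sM ⟨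
      ι G ℚ.* (r ℚ.* ι M ℚ.* (s ℚ.* ι M)) ℚ.+ ι G ℚ.* (ε ℚ.* ι (M * M)) ℚ.+ ι k ℚ.* ι (G * (M * M))
        ≡⟨ cong₂ (λ x y → ι G ℚ.* (r ℚ.* ι M ℚ.* (s ℚ.* ι M)) ℚ.+ ι G ℚ.* (ε ℚ.* x) ℚ.+ ι k ℚ.* y)
             (ι-* M M) (trans (ι-* G (M * M)) (cong (ι G ℚ.*_) (ι-* M M))) ⟩
      ι G ℚ.* (r ℚ.* ι M ℚ.* (s ℚ.* ι M)) ℚ.+ ι G ℚ.* (ε ℚ.* (ι M ℚ.* ι M)) ℚ.+ ι k ℚ.* (ι G ℚ.* (ι M ℚ.* ι M))
        ≡⟨ solve 6 (λ r s e k g m → g :* (r :* m :* (s :* m)) :+ g :* (e :* (m :* m)) :+ k :* (g :* (m :* m)) :=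
             (r :* s :+ e :+ k) :* (g :* (m :* m))) refl r s ε (ι k) (ι G) (ι M) ⟩
      (r ℚ.* s ℚ.+ ε ℚ.+ ι k) ℚ.* (ι G ℚ.* (ι M ℚ.* ι M))
        ≡⟨ cong ((r ℚ.* s ℚ.+ ε ℚ.+ ι k) ℚ.*_) (trans (ι-* G (M * M)) (cong (ι G ℚ.*_) (ι-* M M))) ⟨
      (r ℚ.* s ℚ.+ ε ℚ.+ ι k) ℚ.* ι (G * (M * M)) ∎
    unscaled : ι N ℚ.+ R ℚ.* ι k ℚ.≤ r ℚ.* s ℚ.+ ε ℚ.+ ι k
    unscaled = ℚ.*-cancelʳ-≤-pos (ι (G * (M * M))) {{ι-positive (G * (M * M)) {{nz}}}} scaled

  module _ (k : ℕ) .{{k≢0 : NonZero k}} (q₁ q₂ : ℚ) where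
    private
      G = expNumerator k
      G≢0 : NonZero G
      G≢0 = >-nonZero (≤-trans (>-nonZero⁻¹ (k !) {{k !≢0}}) (m≤m+n (k !) (expTail k)))
      c = suc (numerator q₁) + suc (numerator q₂)

      error : ∀ m {ε} → ι c ℚ.≤ ε ℚ.* ι (suc m) →
        ι (rootNumerator k q₁ m + suc (rootNumerator k q₂ m)) ℚ.≤ ε ℚ.* ι (suc m * suc m)
      error m {ε} small = begin
        ι (rootNumerator k q₁ m + suc (rootNumerator k q₂ m))
          ≤⟨ ι-mono {rootNumerator k q₁ m + suc (rootNumerator k q₂ m)} {c * M} (≤-trans
               (+-mono-≤ (<⇒≤ (rootNumerator-upper k q₁ m)) (rootNumerator-upper k q₂ m))
               (≤-reflexive (sym (*-distribʳ-+ M (suc (numerator q₁)) (suc (numerator q₂)))))) ⟩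
        ι (c * M)              ≡⟨ ι-* c M ⟩
        ι c ℚ.* ι M            ≤⟨ ℚ.*-monoʳ-≤-nonNeg (ι M) {{ι-nonNegative M}} small ⟩
        ε ℚ.* ι M ℚ.* ι M      ≡⟨ ℚ.*-assoc ε (ι M) (ι M) ⟩
        ε ℚ.* (ι M ℚ.* ι M)    ≡⟨ cong (ε ℚ.*_) (ι-* M M) ⟨
        ε ℚ.* ι (M * M)        ∎
        where
        open ℚ.≤-Reasoning
        M = suc m

    roots-bound : ∀ {z x n} .{{_ : NonZero z}} →
      numerator q₁ * z ≡ x * ↧ₙ q₁ → numerator q₂ ≡ n * ↧ₙ q₂ →
      ∀ N → z * root-argument k N ^ k ≤ G ^ k * (x * n) →
      ℕ→ℝ N R.≤ root k q₁ R.* root k q₂ R.+ ((e R.- ℕ→ℝ 1) R.÷ e) R.* ℕ→ℝ k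
    roots-bound {z} {x} {n} {{z≢0}} eq₁ eq₂ N bound ε 0<ε = conclude (archimedean c {ε} 0<ε)
      where
      w = root-argument k N
      eventually : ∀ m → ι c ℚ.≤ ε ℚ.* ι (suc m) → k ≤ m →
        ι N ℚ.≤ (ℤ.+ rootNumerator k q₁ m ℚ./ suc m) ℚ.* (ℤ.+ rootNumerator k q₂ m ℚ./ suc m) ℚ.+
          (partialSum m ℚ.- ι 1) ℚ.* recip (partialSum m) ℚ.* ι k ℚ.+ ε
      eventually m small k≤m = rational-bound {N} {k} {G} {k !} {w}
        {rootNumerator k q₁ m} {rootNumerator k q₂ m} {suc m} {partialSum m} {recip (partialSum m)}
        {ℤ.+ rootNumerator k q₁ m ℚ./ suc m} {ℤ.+ rootNumerator k q₂ m ℚ./ suc m} {ε} {{G≢0}}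
        (recip-inverseˡ (partialSum m) {{partialSum-positive m}})
        (recip-partialSum {k} {m} k≤m)
        (/-cancel (ℤ.+ rootNumerator k q₁ m) (suc m)) (/-cancel (ℤ.+ rootNumerator k q₂ m) (suc m))
        (≤-trans (m≤n+m∸n (N * G + k * k !) (k * G)) (≤-reflexive (+-comm (k * G) w)))
        (root-product-lower {k} {G} {w} {x} {z} {n} {suc (rootNumerator k q₁ m)} {suc (rootNumerator k q₂ m)}
          {numerator q₁} {↧ₙ q₁} {numerator q₂} {↧ₙ q₂} (suc m) {{k≢0}} {{z≢0}}
          bound eq₁ eq₂ (rootNumerator-lower k q₁ m) (rootNumerator-lower k q₂ m))
        (error m {ε} small)
      conclude : ∃[ n₀ ] (∀ {m} → n₀ ≤ m → ι c ℚ.≤ ε ℚ.* ι m) → ∃[ n₀ ] ∀ m → n₀ ≤ m → _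
      -- Beyond n₀ the truncation error is at most ε; beyond k the partial sums of e are at least
      -- E_k.
      conclude (n₀ , small) = n₀ ⊔ k , λ m le →
        eventually m (small {suc m} (≤-trans (m⊔n≤o⇒m≤o n₀ k le) (n≤1+n m))) (m⊔n≤o⇒n≤o n₀ k le)

  module _ (k n δ : ℕ) .{{_ : NonZero k}} .{{_ : NonZero n}} .{{_ : NonZero δ}} where
    private
      x = δ * (1 + τ k) * k !
      q₁ = (ℤ.+ x ℚ./ ζ k δ) {{ζ-nonZero k δ}}
      q₂ = ℤ.+ n ℚ./ 1
      rhs = root k q₁ R.* root k q₂ R.+ ((e R.- ℕ→ℝ 1) R.÷ e) R.* ℕ→ℝ k

      size≤ : ∀ N → ζ k δ * root-argument k N ^ k ≤ expNumerator k ^ k * (δ * (1 + τ k) * n * k !) → ℕ→ℝ N R.≤ rhs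
      size≤ N bound = roots-bound k q₁ q₂ {ζ k δ} {x} {n} {{ζ-nonZero k δ}}
        (numerator-/ x (ζ k δ) {{ζ-nonZero k δ}})
        (trans (sym (*-identityʳ (numerator q₂))) (numerator-/ n 1))
        N (≤-trans bound (≤-reflexive (cong (expNumerator k ^ k *_) (rearrange (δ * (1 + τ k)) n (k !)))))
        where
        rearrange : ∀ d n f → d * n * f ≡ d * f * n
        rearrange = solve-∀

    Φ≤ : ℕ→ℝ (Φ k n) R.≤ rhs
    Φ≤ = argmax-all id {P = λ N → ℕ→ℝ N R.≤ rhs}
      -- The default 0 of the maximum in `Φ` must obey the bound as well.
      (size≤ 0 (size-bound-empty k δ n 0 refl))
      (All.map⁺ (All.map (λ {A} isB → size≤ ∣ A ∣ (size-bound k δ isB)) (All.all-filter (isB? k) (subsets (suc n)))))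

open import Defs
open import Data.Nat as ℕ using (ℕ; NonZero; _!)
open import Data.Integer using (+_)
open import Data.Rational using (_/_)

theorem1 : (k n δ : ℕ) .{{_ : NonZero k}} .{{_ : NonZero n}} .{{_ : NonZero δ}} →
    ℕ→ℝ (Φ k n) ≤
    root k ((+ (δ ℕ.* (1 ℕ.+ τ k) ℕ.* k !) / ζ k δ) {{ζ-nonZero k δ}}) * root k (+ n / 1)
    + ((e - ℕ→ℝ 1) ÷ e) * ℕ→ℝ k
theorem1 k n δ = Limits.Φ≤ k n δ
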